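{- For every fixed integer $k\ge 2$ and every fixed $\epsilon>0$ there is a polynomial-time algorithm that, given any $k$-ary string $s$, computes a sequence of prefix reversals transforming $s$ into its sorted rearrangement $I(s)$ using at most $(1+\epsilon)\,d_{\rm s}(s)$ prefix reversals, where $d_{\rm s}(s)$ is the minimum possible number.
   Context: A $k$-ary string is a finite word over $\{0,1,\dots,k-1\}$. The prefix reversal (flip) $f^{(i)}$ applied to $s=s_1\cdots s_n$ ($1\le i\le n$) yields $s_i s_{i-1}\cdots s_1 s_{i+1}\cdots s_n$. $I(s)$ denotes the string obtained by sorting the symbols of $s$ in non-decreasing order, and $d_{\rm s}(s)$ is the minimum number of prefix reversals transforming $s$ into $I(s)$. -}

module Defs where

open import Data.Fin.Base using (Fin)
open import Data.Fin.Properties using (≤-decTotalOrder)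
open import Data.Integer.Base using (+_)
open import Data.List.Base using (List; []; _∷_; _++_; map; length; reverse; take; drop; replicate; concatMap)
open import Data.List.Relation.Unary.Enumerates.Setoid using (IsEnumeration)
open import Data.List.Sort using (sort)
open import Data.Maybe.Base using (Maybe; just; nothing)
open import Data.Nat.Base using (ℕ; suc; _+_; _*_; _^_; _≤_)
open import Data.Product.Base using (Σ; ∃-syntax; _×_; _,_)
open import Data.Rational.Base using (ℚ; _/_)
open import Data.Vec.Base as Vec using (Vec; []; _∷_)
open import Function.Bundles using (_↣_; module Injection)
open import Relation.Binary.PropositionalEquality using (_≡_; setoid)

------------------------------------------------------------------------
-- Strings and prefix reversals

Str : ℕ → Set
Str k = List (Fin k)

I : ∀ {k} → Str k → Str k
I {k} = sort (≤-decTotalOrder k)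

reversePrefix : ∀ {k} → ℕ → Str k → Str k
reversePrefix i s = reverse (take i s) ++ drop i s

-- s ⟶⟨ is ⟩ t: performing the reversals with indices is, the head of the
-- list first, turns s into t, every index being admissible when used.

infix 4 _⟶⟨_⟩_

data _⟶⟨_⟩_ {k : ℕ} : Str k → List ℕ → Str k → Set where
  done : ∀ {s} → s ⟶⟨ [] ⟩ s
  flip : ∀ {s t i is} → 1 ≤ i → i ≤ length s →
         reversePrefix i s ⟶⟨ is ⟩ t → s ⟶⟨ i ∷ is ⟩ t

IsSortingDistance : ∀ {k} → Str k → ℕ → Set
IsSortingDistance s d =
  (∃[ is ] (s ⟶⟨ is ⟩ I s) × length is ≡ d) ×
  (∀ is → s ⟶⟨ is ⟩ I s → d ≤ length is)

fromℕ : ℕ → ℚ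
fromℕ n = + n / 1

------------------------------------------------------------------------
-- Deterministic multitape Turing machines

Finite : Set → Set
Finite A = Σ (List A) (IsEnumeration (setoid A))

data Move : Set where
  left stay right : Move

-- A cell is either blank (nothing) or carries a symbol of Γ.  All tapes
-- are infinite in both directions, initially blank except for the input.

record TM (A B : Set) : Set₁ where
  field
    Γ         : Set
    Γ-finite  : Finite Γ
    inSymbol  : A ↣ Γ
    outSymbol : B ↣ Γ
    workTapes : ℕ
    Q         : Set
    Q-finite  : Finite Q
    start     : Q

  -- Tape 0 is the input tape and tape 1 the output tape.
  tapes : ℕ
  tapes = 2 + workTapes

  Cell : Set
  Cell = Maybe Γ

  field
    -- nothing means that the machine halts
    δ : Q → Vec Cell tapes → Maybe (Q × Vec (Cell × Move) tapes)

-- `before` lists the cells to the left of the head, nearest first, and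
-- `after` those to the right; all cells beyond the two lists are blank.

record Tape (Γ : Set) : Set where
  constructor tape
  field
    before  : List (Maybe Γ)
    current : Maybe Γ
    after   : List (Maybe Γ)

open Tape public

module _ {Γ : Set} where

  blankTape : Tape Γ
  blankTape = tape [] nothing []

  wordTape : List Γ → Tape Γ
  wordTape []       = blankTape
  wordTape (x ∷ xs) = tape [] (just x) (map just xs)

  move : Move → Tape Γ → Tape Γ
  move stay  t                    = t
  move left  (tape []       c rs) = tape [] nothing (c ∷ rs)
  move left  (tape (l ∷ ls) c rs) = tape ls l (c ∷ rs)
  move right (tape ls c [])       = tape (c ∷ ls) nothing []
  move right (tape ls c (r ∷ rs)) = tape (c ∷ ls) r rs

  act : Tape Γ → Maybe Γ × Move → Tape Γ
  act (tape ls _ rs) (c , m) = move m (tape ls c rs)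

  -- The tape is blank except for one contiguous copy of the word; the
  -- position of the head is irrelevant.
  Contains : Tape Γ → List Γ → Set
  Contains t w =
    ∃[ a ] ∃[ b ] reverse (before t) ++ current t ∷ after t
                ≡ replicate a nothing ++ map just w ++ replicate b nothing

module Execution {A B : Set} (M : TM A B) where
  open TM M

  Config : Set
  Config = Q × Vec (Tape Γ) tapes

  initial : List A → Config
  initial w =
    start ,
    wordTape (map (Injection.to inSymbol) w) ∷ blankTape ∷ Vec.replicate workTapes blankTape

  step : Config → Maybe Config
  step (q , ts) with δ q (Vec.map current ts)
  ... | nothing        = nothing
  ... | just (q′ , as) = just (q′ , Vec.zipWith act ts as)

  -- Run c n c′: from c the machine halts in c′ after exactly n steps.
  data Run : Config → ℕ → Config → Set where
    halt : ∀ {c} → step c ≡ nothing → Run c 0 c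
    next : ∀ {c c′ c″ n} → step c ≡ just c′ → Run c′ n c″ → Run c (suc n) c″

  HasOutput : Config → List B → Set
  HasOutput (_ , _ ∷ out ∷ _) v = Contains out (map (Injection.to outSymbol) v)

  ComputesWithin : List A → List B → ℕ → Set
  ComputesWithin w v bound =
    ∃[ n ] ∃[ c ] Run (initial w) n c × HasOutput c v × n ≤ bound

-- Every polynomial in n is bounded by one of the form c * n ^ e + c.

PolyTime : {A B : Set} → (List A → List B) → Set₁
PolyTime {A} {B} f =
  Σ (TM A B) λ M → ∃[ c ] ∃[ e ]
    (∀ w → Execution.ComputesWithin M w (f w) (c * length w ^ e + c))

------------------------------------------------------------------------
-- Output format for sequences of reversals

-- Indices are written in unary.  As an index never exceeds the length of
-- the input string, binary notation would give the same notion of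
-- polynomial time.

data Mark : Set where
  tally end : Mark

encode : List ℕ → List Mark
encode = concatMap λ i → replicate i tally ++ end ∷ []

{-# OPTIONS --safe #-}
-- A reversal merges at most one pair of neighbouring blocks (maximal runs of
-- equal symbols) and a sorted string has at most k blocks, so a string with b
-- blocks needs at least b - k reversals; a greedy strategy shows that b + 3k
-- suffice.  Moreover the sorting distance depends only on the string with its
-- runs compressed: deleting symbols never makes sorting harder, and reversals
-- of the compressed string lift to reversals at block boundaries.
--
-- The machine therefore keeps a compressed window of the first L blocks in its
-- finite control and sorts it optimally.  This removes at least L - k blocks
-- with at most L + 3k reversals, and it is repeated until the window is the
-- whole string.  If that is so at once, the result is optimal; otherwise the
-- ratio is at most 1 + ε once L is large enough.

module Submission where

open import Defs
open import Data.Bool.Base using (Bool; true; false)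
open import Data.Fin.Base as Fin using (Fin; toℕ)
import Data.Fin.Properties as Fin
import Data.Integer.Base as ℤ
import Data.Integer.Properties as ℤ
open import Data.List.Base using (List; []; _∷_; _++_; _ʳ++_; [_]; length; reverse; take; drop; map; replicate; foldr; allFin; cartesianProduct)
open import Data.List.Membership.Propositional using (_∈_; _∉_)
open import Data.List.Membership.Propositional.Properties using (∈-∃++; ∈-allFin; ∈-map⁺; ∈-++⁺ˡ; ∈-++⁺ʳ; ∈-cartesianProduct⁺)
open import Data.List.Properties
open import Data.List.Relation.Binary.Permutation.Propositional using (_↭_; ↭-sym; ↭-refl; ↭-trans; ↭⇒↭ₛ)
open import Data.List.Relation.Binary.Permutation.Propositional.Properties using (All-resp-↭; ++↭ʳ++; ↭-reverse; ↭-length; shift)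
open import Data.List.Relation.Binary.Pointwise using (Pointwise-≡⇒≡)
open import Data.List.Relation.Binary.Sublist.Propositional using (_⊆_; []; _∷_; _∷ʳ_)
open import Data.List.Relation.Binary.Sublist.Propositional.Properties using (ʳ++⁺; All-resp-⊆; length-mono-≤)
open import Data.List.Relation.Unary.All as All using (All; []; _∷_)
open import Data.List.Relation.Unary.AllPairs using (AllPairs; []; _∷_)
import Data.List.Relation.Unary.AllPairs.Properties as AllPairs
open import Data.List.Relation.Unary.Any using (here; there; any?)
open import Data.List.Relation.Unary.Linked as Linked using (Linked; []; [-]; _∷_)
open import Data.List.Relation.Unary.Linked.Properties using (AllPairs⇒Linked; Linked⇒AllPairs)
open import Data.List.Relation.Unary.Sorted.TotalOrder.Properties using (↗↭↗⇒≋)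
open import Data.List.Sort using (sort-↭; sort-↗)
open import Data.Maybe.Base using (Maybe; just; nothing)
open import Data.Nat.Base using (ℕ; zero; suc; z≤n; s≤s; NonZero; >-nonZero; >-nonZero⁻¹)
open import Data.Nat.Properties
open import Data.Nat.Tactic.RingSolver using (solve-∀)
open import Data.Product.Base using (Σ; ∃; ∃₂; ∃-syntax; _×_; _,_)
open import Data.Rational.Base as ℚ using (ℚ; mkℚ; 0ℚ; 1ℚ; toℚᵘ)
import Data.Rational.Properties as ℚ
open import Data.Rational.Unnormalised.Base as ℚᵘ using (mkℚᵘ; *≤*)
import Data.Rational.Unnormalised.Properties as ℚᵘ
open import Data.Sum.Base using (_⊎_; inj₁; inj₂)
open import Data.Sum.Properties using (inj₁-injective; inj₂-injective)
open import Data.Unit.Base using (⊤; tt)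
open import Data.Vec.Base as Vec using (Vec; []; _∷_)
open import Function.Base using (_∘_)
open import Function.Bundles using (mk↣)
open import Relation.Binary.PropositionalEquality using (_≡_; _≢_; refl; sym; trans; cong; cong₂; subst; subst₂; module ≡-Reasoning)
open import Relation.Nullary using (Dec; yes; no; contradiction)

-- With `k` and the window size fixed there are finitely many windows, so the transition function
-- may look up an optimal reversal for each of them, and the exhaustive search behind it costs no
-- machine steps. Positions, by contrast, cannot be held in the control, because blocks are
-- arbitrarily long. A reversal of the window is therefore executed by walking over whole blocks of
-- the real string, and the walk itself writes the index in unary. For this a change of symbol must
-- mark the end of a block, so a string `s` is always described by a `t` without adjacent
-- repetitions such that `Expands t s`. It is split as `c ++ e`, where `c` is the window and `e` is
-- unknown to the machine; reversals of `c` may make its last block merge with `e` unnoticed, and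
-- the invariant has to survive this.
--
-- The count is amortised: with M = L - k, a round spends M + 4k reversals on M blocks, and the last
-- round adds 3k. The additive terms are absorbed only when there are at least L blocks; shorter
-- inputs rely on exact optimality instead.

module _ {k : ℕ} where

  open import Data.Nat.Base using (_+_; _*_; _≤_; _<_)

  -- Sortability within a given number of reversals

  Sorted : Str k → Set
  Sorted = Linked Fin._≤_

  -- Index 0 is allowed and acts as an idle move, which makes the notion monotone in the number of
  -- reversals; the bound on the index makes it decidable by search.
  Sortable : ℕ → Str k → Set
  Sortable zero    s = Sorted s
  Sortable (suc n) s = ∃[ i ] i < suc (length s) × Sortable n (reversePrefix i s)

  sortable? : ∀ n s → Dec (Sortable n s)
  sortable? zero    s = Linked.linked? Fin._≤?_ s
  sortable? (suc n) s = anyUpTo? (λ i → sortable? n (reversePrefix i s)) (suc (length s))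

  reversePrefix-ʳ++ : ∀ (u v : Str k) → reversePrefix (length u) (u ++ v) ≡ u ʳ++ v
  reversePrefix-ʳ++ u v = trans
    (cong₂ (λ a b → reverse a ++ b) (take-++ u v) (drop-++ u v))
    (sym (ʳ++-defn u))
    where
    take-++ : ∀ (u v : Str k) → take (length u) (u ++ v) ≡ u
    take-++ []      v = refl
    take-++ (x ∷ u) v = cong (x ∷_) (take-++ u v)
    drop-++ : ∀ (u v : Str k) → drop (length u) (u ++ v) ≡ v
    drop-++ []      v = refl
    drop-++ (x ∷ u) v = drop-++ u v

  -- With a reversal written as the passage from `u ++ v` to `u ʳ++ v`, index arithmetic disappears
  -- and inductions on `u` move one symbol at a time.
  sortable-ʳ++⁺ : ∀ {n} (u v : Str k) → Sortable n (u ʳ++ v) → Sortable (suc n) (u ++ v)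
  sortable-ʳ++⁺ {n} u v S =
    length u , s≤s (≤-trans (m≤m+n _ _) (≤-reflexive (sym (length-++ u)))) ,
    subst (Sortable n) (sym (reversePrefix-ʳ++ u v)) S

  sortable-ʳ++⁻ : ∀ {n} {s : Str k} → Sortable (suc n) s → ∃₂ λ u v → s ≡ u ++ v × Sortable n (u ʳ++ v)
  sortable-ʳ++⁻ {n} {s} (i , _ , S) =
    take i s , drop i s , sym (take++drop≡id i s) , subst (Sortable n) (sym (ʳ++-defn (take i s))) S

  sortable-mono : ∀ {m n} {s : Str k} → m ≤ n → Sortable m s → Sortable n s
  sortable-mono {zero}  {zero}  _  S             = S
  sortable-mono {zero}  {suc n} _  S             = 0 , s≤s z≤n , sortable-mono {zero} {n} z≤n S
  sortable-mono {suc m} {suc n} (s≤s m≤n) (i , i< , S) = i , i< , sortable-mono m≤n S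

  -- By monotonicity the downward search may stop at the first failure.
  least-sortable : ∀ n {s} → Sortable n s → ∃[ d ] Sortable d s × (∀ m → Sortable m s → d ≤ m)
  least-sortable zero        S = 0 , S , λ _ _ → z≤n
  least-sortable (suc n) {s} S with sortable? n s
  ... | yes S′ = least-sortable n S′
  ... | no ¬S′ = suc n , S , λ m S″ → ≰⇒> λ m≤n → ¬S′ (sortable-mono m≤n S″)

  -- Deleting symbols

  sorted-⊆ : ∀ {s t : Str k} → t ⊆ s → Sorted s → Sorted t
  sorted-⊆ τ S = AllPairs⇒Linked (go τ (Linked⇒AllPairs Fin.≤-trans S))
    where
    go : ∀ {s t : Str k} → t ⊆ s → AllPairs Fin._≤_ s → AllPairs Fin._≤_ t
    go []         []       = []
    go (y ∷ʳ τ)   (_ ∷ ps) = go τ ps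
    go (refl ∷ τ) (p ∷ ps) = All-resp-⊆ τ p ∷ go τ ps

  ⊆-++⁻ : ∀ (u v : Str k) {t} → t ⊆ u ++ v → ∃₂ λ u′ v′ → t ≡ u′ ++ v′ × u′ ⊆ u × v′ ⊆ v
  ⊆-++⁻ []      v τ = [] , _ , refl , [] , τ
  ⊆-++⁻ (x ∷ u) v (.x ∷ʳ τ) with u′ , v′ , e , τ₁ , τ₂ ← ⊆-++⁻ u v τ = u′ , v′ , e , x ∷ʳ τ₁ , τ₂
  ⊆-++⁻ (x ∷ u) v (refl ∷ τ) with u′ , v′ , e , τ₁ , τ₂ ← ⊆-++⁻ u v τ = x ∷ u′ , v′ , cong (x ∷_) e , refl ∷ τ₁ , τ₂

  -- Each reversal of the longer string restricts to the surviving symbols: they split at the same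
  -- place, and reversing commutes with deletion.
  sortable-⊆ : ∀ n {s t : Str k} → t ⊆ s → Sortable n s → Sortable n t
  sortable-⊆ zero    τ S = sorted-⊆ τ S
  sortable-⊆ (suc n) τ S with u , v , refl , S′ ← sortable-ʳ++⁻ S with u′ , v′ , refl , τ₁ , τ₂ ← ⊆-++⁻ u v τ =
    sortable-ʳ++⁺ u′ v′ (sortable-⊆ n (ʳ++⁺ τ₁ τ₂) S′)

  -- Repeating symbols

  data Expands : Str k → Str k → Set where
    []   : Expands [] []
    keep : ∀ {t s} x → Expands t s → Expands (x ∷ t) (x ∷ s)
    dup  : ∀ {t s} x → Expands (x ∷ t) s → Expands (x ∷ t) (x ∷ s)

  expands-⊆ : ∀ {t s} → Expands t s → t ⊆ s
  expands-⊆ []         = []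
  expands-⊆ (keep x e) = refl ∷ expands-⊆ e
  expands-⊆ (dup x e)  = x ∷ʳ expands-⊆ e

  expands-refl : ∀ s → Expands s s
  expands-refl []      = []
  expands-refl (x ∷ s) = keep x (expands-refl s)

  expands-trans : ∀ {t s r} → Expands t s → Expands s r → Expands t r
  expands-trans []         []          = []
  expands-trans (keep x e) (keep _ e′) = keep x (expands-trans e e′)
  expands-trans e@(keep x _) (dup _ e′) = dup x (expands-trans e e′)
  expands-trans (dup x e)  (keep _ e′) = dup x (expands-trans e e′)
  expands-trans e@(dup x _) (dup _ e′) = dup x (expands-trans e e′)

  expands-++ : ∀ {t s t′ s′} → Expands t s → Expands t′ s′ → Expands (t ++ t′) (s ++ s′)
  expands-++ []         e′ = e′
  expands-++ (keep x e) e′ = keep x (expands-++ e e′)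
  expands-++ (dup x e)  e′ = dup x (expands-++ e e′)

  expands-++⁻ : ∀ t {t′ s} → Expands (t ++ t′) s → ∃₂ λ u v → s ≡ u ++ v × Expands t u × Expands t′ v
  expands-++⁻ []      e          = [] , _ , refl , [] , e
  expands-++⁻ (x ∷ t) (keep _ e) with u , v , refl , e₁ , e₂ ← expands-++⁻ t e = x ∷ u , v , refl , keep x e₁ , e₂
  expands-++⁻ (x ∷ t) (dup _ e)  with u , v , refl , e₁ , e₂ ← expands-++⁻ (x ∷ t) e = x ∷ u , v , refl , dup x e₁ , e₂

  mutual
    expands-ʳ++ : ∀ {t s t′ s′} → Expands t s → Expands t′ s′ → Expands (t ʳ++ t′) (s ʳ++ s′)
    expands-ʳ++ []         e′ = e′
    expands-ʳ++ (keep x e) e′ = expands-ʳ++ e (keep x e′)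
    expands-ʳ++ (dup x e)  e′ = expands-ʳ++-merge e (keep x e′)

    -- Covers the situation in the middle of a run: the single `x` of the short string has been
    -- moved already, while further copies in the long string still follow. Each of them becomes a
    -- `dup` on the other side.
    expands-ʳ++-merge : ∀ {x t s t′ s′} → Expands (x ∷ t) s → Expands (x ∷ t′) (x ∷ s′) →
                        Expands (t ʳ++ x ∷ t′) (s ʳ++ x ∷ s′)
    expands-ʳ++-merge (keep x e) e′ = expands-ʳ++ e (dup x e′)
    expands-ʳ++-merge (dup x e)  e′ = expands-ʳ++-merge e (dup x e′)

  sorted-expands : ∀ {t s} → Expands t s → Sorted t → Sorted s
  sorted-expands []                          _       = []
  sorted-expands (keep x [])                 _       = [-]
  sorted-expands (keep x e@(keep _ _))       (p ∷ S) = p ∷ sorted-expands e S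
  sorted-expands (keep x e@(dup _ _))        (p ∷ S) = p ∷ sorted-expands e S
  sorted-expands (dup x e@(keep _ _))        S       = Fin.≤-refl ∷ sorted-expands e S
  sorted-expands (dup x e@(dup _ _))         S       = Fin.≤-refl ∷ sorted-expands e S

  sortable-expands : ∀ n {t s} → Expands t s → Sortable n t → Sortable n s
  sortable-expands zero    e S = sorted-expands e S
  sortable-expands (suc n) e S with u , v , refl , S′ ← sortable-ʳ++⁻ S with u′ , v′ , refl , e₁ , e₂ ← expands-++⁻ u e =
    sortable-ʳ++⁺ u′ v′ (sortable-expands n (expands-ʳ++ e₁ e₂) S′)

  -- Compressing runs

  NoStutter : Str k → Set
  NoStutter = Linked _≢_

  compressCons : Fin k → Str k → Str k
  compressCons x []      = x ∷ []
  compressCons x (y ∷ t) with x Fin.≟ y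
  ... | yes _ = y ∷ t
  ... | no  _ = x ∷ y ∷ t

  compress : Str k → Str k
  compress = foldr compressCons []

  expands-compressCons : ∀ x {t s} → Expands t s → Expands (compressCons x t) (x ∷ s)
  expands-compressCons x {[]}    [] = keep x []
  expands-compressCons x {y ∷ t} e with x Fin.≟ y
  ... | yes refl = dup x e
  ... | no  _    = keep x e

  expands-compress : ∀ s → Expands (compress s) s
  expands-compress []      = []
  expands-compress (x ∷ s) = expands-compressCons x (expands-compress s)

  noStutter-compressCons : ∀ x {t} → NoStutter t → NoStutter (compressCons x t)
  noStutter-compressCons x {[]}    _ = [-]
  noStutter-compressCons x {y ∷ t} N with x Fin.≟ y
  ... | yes _  = N
  ... | no x≢y = x≢y ∷ N

  noStutter-compress : ∀ s → NoStutter (compress s)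
  noStutter-compress []      = []
  noStutter-compress (x ∷ s) = noStutter-compressCons x (noStutter-compress s)

  length-compress : ∀ s → length (compress s) ≤ length s
  length-compress []      = z≤n
  length-compress (x ∷ s) = ≤-trans (go (compress s)) (s≤s (length-compress s))
    where
    go : ∀ t → length (compressCons x t) ≤ suc (length t)
    go []      = ≤-refl
    go (y ∷ t) with x Fin.≟ y
    ... | yes _ = n≤1+n _
    ... | no  _ = ≤-refl

  -- Counting blocks

  δ≢ : Fin k → Fin k → ℕ
  δ≢ x y with x Fin.≟ y
  ... | yes _ = 0
  ... | no  _ = 1

  δ≢-sym : ∀ x y → δ≢ x y ≡ δ≢ y x
  δ≢-sym x y with x Fin.≟ y | y Fin.≟ x
  ... | yes _   | yes _   = refl
  ... | yes x≡y | no y≢x  = contradiction (sym x≡y) y≢x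
  ... | no x≢y  | yes y≡x = contradiction (sym y≡x) x≢y
  ... | no _    | no _    = refl

  δ≢≤1 : ∀ x y → δ≢ x y ≤ 1
  δ≢≤1 x y with x Fin.≟ y
  ... | yes _ = z≤n
  ... | no  _ = ≤-refl

  blocks : Str k → ℕ
  blocks []          = 0
  blocks (x ∷ [])    = 1
  blocks (x ∷ y ∷ s) = δ≢ x y + blocks (y ∷ s)

  blocks-∷ : ∀ x s → blocks s ≤ blocks (x ∷ s)
  blocks-∷ x []      = z≤n
  blocks-∷ x (y ∷ s) = m≤n+m _ _

  blocks-++ : ∀ u v → blocks (u ++ v) ≤ blocks u + blocks v
  blocks-++ []          v       = ≤-refl
  blocks-++ (x ∷ [])    []      = ≤-refl
  blocks-++ (x ∷ [])    (y ∷ v) = +-monoˡ-≤ _ (δ≢≤1 x y)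
  blocks-++ (x ∷ y ∷ u) v       = ≤-trans (+-monoʳ-≤ (δ≢ x y) (blocks-++ (y ∷ u) v)) (≤-reflexive (sym (+-assoc (δ≢ x y) _ _)))

  -- Moving the next symbol `y` across shifts the adjacency of `x` and `y` from the left summand to
  -- the right one, at equal cost by symmetry of `δ≢`. The pivot lies in both lists and is counted
  -- twice, hence the `suc`.
  blocks-ʳ++-∷ : ∀ x u v → blocks (x ∷ u) + blocks (x ∷ v) ≤ suc (blocks (u ʳ++ x ∷ v))
  blocks-ʳ++-∷ x []      v = ≤-refl
  blocks-ʳ++-∷ x (y ∷ u) v = ≤-trans (≤-reflexive shuffle) (blocks-ʳ++-∷ y u (x ∷ v))
    where
    shuffle : δ≢ x y + blocks (y ∷ u) + blocks (x ∷ v) ≡ blocks (y ∷ u) + (δ≢ y x + blocks (x ∷ v))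
    shuffle rewrite δ≢-sym x y | +-comm (δ≢ y x) (blocks (y ∷ u)) = +-assoc (blocks (y ∷ u)) (δ≢ y x) _

  blocks-ʳ++ : ∀ u v → blocks (u ++ v) ≤ suc (blocks (u ʳ++ v))
  blocks-ʳ++ []      v = n≤1+n _
  blocks-ʳ++ (x ∷ u) v = ≤-trans (blocks-++ (x ∷ u) v)
    (≤-trans (+-monoʳ-≤ (blocks (x ∷ u)) (blocks-∷ x v)) (blocks-ʳ++-∷ x u v))

  blocks-noStutter : ∀ {t} → NoStutter t → blocks t ≡ length t
  blocks-noStutter []        = refl
  blocks-noStutter [-]       = refl
  blocks-noStutter {x ∷ y ∷ _} (x≢y ∷ N) with x Fin.≟ y
  ... | yes x≡y = contradiction x≡y x≢y
  ... | no  _   = cong suc (blocks-noStutter N)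

  blocks-sorted : ∀ s → Sorted s → blocks s ≤ k
  blocks-sorted []      _ = z≤n
  blocks-sorted (x ∷ s) S = m+n≤o⇒m≤o _ (go x s S)
    where
    -- The blocks carry distinct values, none below `x`, and only k - `toℕ x` such values exist.
    go : ∀ x s → Sorted (x ∷ s) → blocks (x ∷ s) + toℕ x ≤ k
    go x []      _       = Fin.toℕ<n x
    go x (y ∷ s) (p ∷ S) with x Fin.≟ y
    ... | yes refl = go y s S
    ... | no  x≢y  = ≤-trans
      (≤-trans (≤-reflexive (sym (+-suc (blocks (y ∷ s)) (toℕ x))))
               (+-monoʳ-≤ (blocks (y ∷ s)) (≤∧≢⇒< p (x≢y ∘ Fin.toℕ-injective))))
      (go y s S)

  blocks-sortable : ∀ n s → Sortable n s → blocks s ≤ n + k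
  blocks-sortable zero    s S = blocks-sorted s S
  blocks-sortable (suc n) s S with u , v , refl , S′ ← sortable-ʳ++⁻ S =
    ≤-trans (blocks-ʳ++ u v) (s≤s (blocks-sortable n _ S′))

  -- Upper bounds

  All-ʳ++ : ∀ {P : Fin k → Set} u {v} → All P (u ++ v) → All P (u ʳ++ v)
  All-ʳ++ u {v} = All-resp-↭ (++↭ʳ++ u v)

  -- All reversals stay inside `s`, so a maximal last symbol keeps its final place.
  sortable-∷ʳ : ∀ n {s m} → All (Fin._≤ m) s → Sortable n s → Sortable n (s ++ [ m ])
  sortable-∷ʳ zero {s} {m} ≤m S = AllPairs⇒Linked
    (AllPairs.++⁺ (Linked⇒AllPairs Fin.≤-trans S) ([] ∷ []) (All.map (_∷ []) ≤m))
  sortable-∷ʳ (suc n) {s} {m} ≤m S with u , v , refl , S′ ← sortable-ʳ++⁻ S =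
    subst (Sortable (suc n)) (sym (++-assoc u v [ m ]))
      (sortable-ʳ++⁺ u (v ++ [ m ]) (subst (Sortable n) (sym assoc) (sortable-∷ʳ n (All-ʳ++ u ≤m) S′)))
    where
    assoc : u ʳ++ (v ++ [ m ]) ≡ (u ʳ++ v) ++ [ m ]
    assoc = trans (ʳ++-defn u) (trans (sym (++-assoc (reverse u) v _)) (cong (_++ [ m ]) (sym (ʳ++-defn u))))

  split-max : ∀ x (s : Str k) → ∃[ u ] ∃[ m ] ∃[ v ] x ∷ s ≡ u ++ m ∷ v × All (Fin._≤ m) (u ++ v)
  split-max x []      = [] , x , [] , refl , []
  split-max x (y ∷ s) with u , m , v , eq , ≤m ← split-max y s | Fin.≤-total x m
  ... | inj₁ x≤m = x ∷ u , m , v , cong (x ∷_) eq , x≤m ∷ ≤m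
  ... | inj₂ m≤x = [] , x , y ∷ s , refl ,
    subst (All (Fin._≤ x)) (sym eq)
      (All-resp-↭ (↭-sym (shift m u v)) (m≤x ∷ All.map (λ ≤m → Fin.≤-trans ≤m m≤x) ≤m))

  -- Two reversals settle a maximal symbol: one brings it to the front, a reversal of the whole
  -- string sends it to the end, where `sortable-∷ʳ` leaves it.
  sortable-pancake : ∀ n s → length s ≡ n → Sortable (n + n) s
  sortable-pancake zero    []      _  = []
  sortable-pancake (suc n) (x ∷ s) eq with u , m , v , eq′ , ≤m ← split-max x s =
    subst (λ j → Sortable (suc j) (x ∷ s)) (sym (+-suc n n)) (subst (Sortable (2 + (n + n))) (sym split)
      (sortable-ʳ++⁺ (u ++ [ m ]) v
        (subst (Sortable (suc (n + n))) (trans (++-identityʳ _) (sym (++-ʳ++ u)))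
          (sortable-ʳ++⁺ (m ∷ (u ʳ++ v)) [] (subst (Sortable (n + n)) (sym (ʳ++-defn (u ʳ++ v)))
            (sortable-∷ʳ (n + n) (All-resp-↭ (↭-sym (↭-reverse (u ʳ++ v))) (All-ʳ++ u ≤m))
              (sortable-pancake n _ len)))))))
    where
    split : x ∷ s ≡ (u ++ [ m ]) ++ v
    split = trans eq′ (sym (++-assoc u _ v))
    len : length (reverse (u ʳ++ v)) ≡ n
    len = suc-injective (begin
      suc (length (reverse (u ʳ++ v))) ≡⟨ cong suc (length-reverse (u ʳ++ v)) ⟩
      suc (length (u ʳ++ v))           ≡⟨ cong suc (↭-length (↭-sym (++↭ʳ++ u v))) ⟩
      suc (length (u ++ v))            ≡⟨ ↭-length (↭-sym (shift m u v)) ⟩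
      length (u ++ m ∷ v)              ≡⟨ cong length (sym eq′) ⟩
      suc (length s)                   ≡⟨ eq ⟩
      suc n                            ∎)
      where open ≡-Reasoning

  All-∈-remove : ∀ {a : Fin k} X {Y s} → a ∉ s → All (_∈ X ++ a ∷ Y) s → All (_∈ X ++ Y) s
  All-∈-remove X         a∉s []       = []
  All-∈-remove {a} X {Y} a∉s (p ∷ ps) = remove X p (a∉s ∘ here ∘ sym) ∷ All-∈-remove X (a∉s ∘ there) ps
    where
    remove : ∀ X {b} → b ∈ X ++ a ∷ Y → b ≢ a → b ∈ X ++ Y
    remove []      (here b≡a) b≢a = contradiction b≡a b≢a
    remove []      (there p)  b≢a = p
    remove (x ∷ X) (here p)   b≢a = here p
    remove (x ∷ X) (there p)  b≢a = there (remove X p b≢a)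

  -- Greedy sorting of u ++ v: if the first symbol of u occurs again in u, a
  -- single reversal makes it meet that occurrence; otherwise reversing u sends
  -- it to v for good, and u needs one symbol of the alphabet X less.
  sortable-greedy : ∀ n u v X → length u ≡ n → All (_∈ X) u →
                    Sortable (n + length X + ((length X + length v) + (length X + length v))) (u ++ v)
  sortable-greedy zero    []      v X _   _ =
    sortable-mono (≤-trans (+-mono-≤ (m≤n+m (length v) (length X)) (m≤n+m (length v) (length X))) (m≤n+m _ (length X)))
                  (sortable-pancake (length v) v refl)
  sortable-greedy (suc n) (a ∷ y) v X len (a∈X ∷ y⊆X) with any? (a Fin.≟_) y
  ... | yes a∈y with y₁ , y₂ , refl ← ∈-∃++ a∈y =
    subst (Sortable _) (sym split)
      (sortable-ʳ++⁺ (a ∷ y₁) ((a ∷ y₂) ++ v)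
        (sortable-expands _ merged (subst (Sortable _) (cong (_++ v) (sym (ʳ++-defn y₁)))
          (sortable-greedy n (reverse y₁ ++ a ∷ y₂) v X len′
            (subst (All (_∈ X)) (ʳ++-defn y₁) (All-ʳ++ y₁ y⊆X))))))
    where
    split : a ∷ ((y₁ ++ a ∷ y₂) ++ v) ≡ a ∷ (y₁ ++ a ∷ (y₂ ++ v))
    split = cong (a ∷_) (++-assoc y₁ _ v)
    len′ : length (reverse y₁ ++ a ∷ y₂) ≡ n
    len′ = trans (cong length (sym (ʳ++-defn y₁))) (trans (↭-length (↭-sym (++↭ʳ++ y₁ (a ∷ y₂)))) (suc-injective len))
    merged : Expands ((y₁ ʳ++ a ∷ y₂) ++ v) (y₁ ʳ++ (a ∷ a ∷ (y₂ ++ v)))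
    merged = subst (λ t → Expands t (y₁ ʳ++ (a ∷ a ∷ (y₂ ++ v))))
      (trans (ʳ++-defn y₁) (trans (sym (++-assoc (reverse y₁) _ v)) (cong (_++ v) (sym (ʳ++-defn y₁)))))
      (expands-ʳ++ (expands-refl y₁) (dup a (expands-refl (a ∷ y₂ ++ v))))
  ... | no a∉y with X₁ , X₂ , refl ← ∈-∃++ a∈X =
    sortable-mono bound (sortable-ʳ++⁺ (a ∷ y) v
      (subst (Sortable _) (sym (ʳ++-defn y))
        (sortable-greedy n (reverse y) (a ∷ v) (X₁ ++ X₂) (trans (length-reverse y) (suc-injective len))
          (All-resp-↭ (↭-sym (↭-reverse y)) (All-∈-remove X₁ a∉y y⊆X)))))
    where
    bound : suc (n + length (X₁ ++ X₂) + ((length (X₁ ++ X₂) + suc (length v)) + (length (X₁ ++ X₂) + suc (length v))))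
            ≤ suc n + length (X₁ ++ a ∷ X₂) + ((length (X₁ ++ a ∷ X₂) + length v) + (length (X₁ ++ a ∷ X₂) + length v))
    bound rewrite length-++ X₁ {a ∷ X₂} | length-++ X₁ {X₂} | +-suc (length X₁) (length X₂)
                | +-suc (length X₁ + length X₂) (length v)
                | +-suc n (length X₁ + length X₂) = n≤1+n _

  -- The greedy bound with the whole alphabet as `X` and `v` empty. A symbol enters `v` only when
  -- one leaves `X`, so `length X + length v` stays equal to k and the final `sortable-pancake` is
  -- affordable with 2k reversals.
  sortable-blocks : ∀ s → Sortable (length s + 3 * k) s
  sortable-blocks s = subst (Sortable _) (++-identityʳ s)
    (subst (λ j → Sortable j (s ++ [])) count
      (sortable-greedy (length s) s [] (allFin k) refl (All.tabulate λ _ → ∈-allFin _)))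
    where
    count : length s + length (allFin k) + ((length (allFin k) + 0) + (length (allFin k) + 0)) ≡ length s + 3 * k
    count rewrite length-tabulate {n = k} (λ x → x) = lemma (length s) k
      where
      lemma : ∀ l k → l + k + ((k + 0) + (k + 0)) ≡ l + 3 * k
      lemma = solve-∀

  sorting-distance : (s : Str k) → ∃[ d ] Sortable d s × (∀ m → Sortable m s → d ≤ m)
  sorting-distance s = least-sortable _ (sortable-blocks s)

  -- From Sortable to sequences of admissible reversals

  ⟶-↭ : ∀ {s t : Str k} {is} → s ⟶⟨ is ⟩ t → t ↭ s
  ⟶-↭ done                     = ↭-refl
  ⟶-↭ (flip {s} {i = i} _ _ r) = ↭-trans (⟶-↭ r)
    (subst (reversePrefix i s ↭_) (take++drop≡id i s)
      (subst (_↭ take i s ++ drop i s) (ʳ++-defn (take i s)) (↭-sym (++↭ʳ++ (take i s) (drop i s)))))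

  ⟶-sorted : ∀ {s t : Str k} {is} → s ⟶⟨ is ⟩ t → Sorted t → s ⟶⟨ is ⟩ I s
  ⟶-sorted {s} {t} {is} r S = subst (s ⟶⟨ is ⟩_)
    (Pointwise-≡⇒≡ (↗↭↗⇒≋ (Fin.≤-totalOrder k) S (sort-↗ (Fin.≤-decTotalOrder k) s)
      (↭⇒↭ₛ (↭-trans (⟶-↭ r) (↭-sym (sort-↭ (Fin.≤-decTotalOrder k) s)))))) r

  ⟶-trans : ∀ {s t r : Str k} {is js} → s ⟶⟨ is ⟩ t → t ⟶⟨ js ⟩ r → s ⟶⟨ is ++ js ⟩ r
  ⟶-trans done           r′ = r′
  ⟶-trans (flip p q r) r′ = flip p q (⟶-trans r r′)

  ⟶⇒sortable : ∀ {s t : Str k} {is} → s ⟶⟨ is ⟩ t → Sorted t → Sortable (length is) s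
  ⟶⇒sortable done           S = S
  ⟶⇒sortable (flip p q r) S = _ , s≤s q , ⟶⇒sortable r S

  sortable⇒⟶ : ∀ n {s : Str k} → Sortable n s → ∃₂ λ is t → s ⟶⟨ is ⟩ t × Sorted t × length is ≤ n
  sortable⇒⟶ zero    S                   = [] , _ , done , S , z≤n
  -- Idle moves are inadmissible as reversals and are dropped; hence only an inequality for the
  -- length.
  sortable⇒⟶ (suc n) (zero  , _ , S)     with is , t , r , St , b ← sortable⇒⟶ n S =
    is , t , r , St , m≤n⇒m≤1+n b
  sortable⇒⟶ (suc n) (suc i , s≤s i≤ , S) with is , t , r , St , b ← sortable⇒⟶ n S =
    suc i ∷ is , t , flip (s≤s z≤n) i≤ r , St , s≤s b

  isSortingDistance : ∀ {s d} → Sortable d s → (∀ m → Sortable m s → d ≤ m) → IsSortingDistance s d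
  isSortingDistance {s} S min with is , t , r , St , b ← sortable⇒⟶ _ S =
    (is , ⟶-sorted r St , ≤-antisym b (min _ (⟶⇒sortable r St))) ,
    λ js r′ → min _ (⟶⇒sortable r′ (sort-↗ (Fin.≤-decTotalOrder k) s))

  -- A compressed window followed by a compressed rest

  noStutter-++⁻ʳ : ∀ c {e : Str k} → NoStutter (c ++ e) → NoStutter e
  noStutter-++⁻ʳ []      N = N
  noStutter-++⁻ʳ (x ∷ c) N = noStutter-++⁻ʳ c (Linked.tail N)

  noStutter-++⁻ˡ : ∀ c {e : Str k} → NoStutter (c ++ e) → NoStutter c
  noStutter-++⁻ˡ []          N        = []
  noStutter-++⁻ˡ (x ∷ [])    N        = [-]
  noStutter-++⁻ˡ (x ∷ y ∷ c) (p ∷ N) = p ∷ noStutter-++⁻ˡ (y ∷ c) N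

  -- Two compressed strings meet with at most one repetition, which is removed
  -- from the second.
  noStutter-join : ∀ c e → NoStutter c → NoStutter e →
                   ∃[ e′ ] NoStutter (c ++ e′) × Expands (c ++ e′) (c ++ e) × length e′ ≤ length e
  noStutter-join []          e       N N′ = e , N′ , expands-refl e , ≤-refl
  noStutter-join (x ∷ [])    []      N N′ = [] , N , expands-refl _ , ≤-refl
  noStutter-join (x ∷ [])    (y ∷ e) N N′ with x Fin.≟ y
  ... | yes refl = e , N′ , dup x (expands-refl _) , n≤1+n _
  ... | no  x≢y  = y ∷ e , x≢y ∷ N′ , expands-refl _ , ≤-refl
  noStutter-join (x ∷ y ∷ c) e (x≢y ∷ N) N′ with e′ , N″ , E , l ← noStutter-join (y ∷ c) e N N′ =
    e′ , x≢y ∷ N″ , keep x E , l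

  δ≢-refl : ∀ (x : Fin k) → δ≢ x x ≡ 0
  δ≢-refl x with x Fin.≟ x
  ... | yes _  = refl
  ... | no x≢x = contradiction refl x≢x

  blocks-dup : ∀ x s → blocks (x ∷ x ∷ s) ≡ blocks (x ∷ s)
  blocks-dup x s = cong (_+ blocks (x ∷ s)) (δ≢-refl x)

  blocks-expands : ∀ {t s} → Expands t s → blocks s ≡ blocks t
  blocks-expands []                      = refl
  blocks-expands (keep x [])             = refl
  blocks-expands (keep x e@(keep y _))   = cong (δ≢ x y +_) (blocks-expands e)
  blocks-expands (keep x e@(dup y _))    = cong (δ≢ x y +_) (blocks-expands e)
  blocks-expands (dup x e@(keep {s = s} .x _))= trans (blocks-dup x s) (blocks-expands e)
  blocks-expands (dup x e@(dup {s = s} .x _)) = trans (blocks-dup x s) (blocks-expands e)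

  blocks≡length : ∀ {t s} → NoStutter t → Expands t s → blocks s ≡ length t
  blocks≡length N E = trans (blocks-expands E) (blocks-noStutter N)

  blocks≤length : ∀ (s : Str k) → blocks s ≤ length s
  blocks≤length []          = z≤n
  blocks≤length (x ∷ [])    = ≤-refl
  blocks≤length (x ∷ y ∷ s) = +-mono-≤ (δ≢≤1 x y) (blocks≤length (y ∷ s))

  length-reversePrefix : ∀ i (s : Str k) → length (reversePrefix i s) ≡ length s
  length-reversePrefix i s = begin
    length (reverse (take i s) ++ drop i s)          ≡⟨ length-++ (reverse (take i s)) ⟩
    length (reverse (take i s)) + length (drop i s)  ≡⟨ cong (_+ length (drop i s)) (length-reverse (take i s)) ⟩
    length (take i s) + length (drop i s)            ≡⟨ sym (length-++ (take i s)) ⟩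
    length (take i s ++ drop i s)                    ≡⟨ cong length (take++drop≡id i s) ⟩
    length s                                         ∎
    where open ≡-Reasoning

  -- The next reversal of an optimal sorting sequence

  firstFlip : ∀ c → ∃[ d ] Sortable d c × (∀ m → Sortable m c → d ≤ m) → Maybe ℕ
  firstFlip c (zero  , _)           = nothing
  firstFlip c (suc d , (i , _) , _) = just i

  -- An optimal sequence is recomputed from the current window before every reversal, so the control
  -- need not store a plan.
  nextFlip : Str k → Maybe ℕ
  nextFlip c = firstFlip c (sorting-distance c)

  Progress : ℕ → Str k → Set
  Progress n c = (nextFlip c ≡ nothing × Sorted c) ⊎
    (∃₂ λ i m → nextFlip c ≡ just i × n ≡ suc m × 1 ≤ i × 1 ≤ length c × Sortable m (compress (reversePrefix i c)))

  -- Recompressing after the reversal only deletes symbols and so cannot raise the distance: every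
  -- optimal reversal lowers the budget `n` by one.
  progress : ∀ n c → Sortable n c → Progress n c
  progress n c S with sorting-distance c
  ... | zero  , S₀ , _ = inj₁ (refl , S₀)
  -- An optimal sequence contains no idle move, since omitting it would give a shorter one.
  ... | suc d , (zero , _ , S₁) , min = contradiction (min d S₁) 1+n≰n
  ... | suc d , (suc i , s≤s i≤ , S₁) , min with n | min n S
  ...   | suc m | s≤s d≤m = inj₂ (suc i , m , refl , refl , s≤s z≤n , ≤-trans (s≤s z≤n) i≤ ,
            sortable-mono d≤m (sortable-⊆ d (expands-⊆ (expands-compress _)) S₁))

  nextFlip-sorted : ∀ {c} → Sorted c → nextFlip c ≡ nothing
  nextFlip-sorted {c} S with progress 0 c S
  ... | inj₁ (eq , _) = eq

-- Finite sets

⊤-finite : Finite ⊤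
⊤-finite = tt ∷ [] , λ _ → here refl

Bool-finite : Finite Bool
Bool-finite = false ∷ true ∷ [] , λ { false → here refl ; true → there (here refl) }

Fin-finite : ∀ n → Finite (Fin n)
Fin-finite n = allFin n , ∈-allFin

Maybe-finite : ∀ {A} → Finite A → Finite (Maybe A)
Maybe-finite (xs , ∈xs) = nothing ∷ map just xs , λ where
  nothing  → here refl
  (just x) → there (∈-map⁺ just (∈xs x))

⊎-finite : ∀ {A B} → Finite A → Finite B → Finite (A ⊎ B)
⊎-finite (xs , ∈xs) (ys , ∈ys) = map inj₁ xs ++ map inj₂ ys , λ where
  (inj₁ x) → ∈-++⁺ˡ (∈-map⁺ inj₁ (∈xs x))
  (inj₂ y) → ∈-++⁺ʳ (map inj₁ xs) (∈-map⁺ inj₂ (∈ys y))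

×-finite : ∀ {A B} → Finite A → Finite B → Finite (A × B)
×-finite (xs , ∈xs) (ys , ∈ys) = cartesianProduct xs ys , λ (x , y) → ∈-cartesianProduct⁺ (∈xs x) (∈ys y)

-- Lists of length at most `n`, encoded so that finiteness follows by recursion on `n` from products
-- and `Maybe`.
Bounded : Set → ℕ → Set
Bounded A zero    = ⊤
Bounded A (suc n) = Maybe (A × Bounded A n)

Bounded-finite : ∀ {A} → Finite A → ∀ n → Finite (Bounded A n)
Bounded-finite F zero    = ⊤-finite
Bounded-finite F (suc n) = Maybe-finite (×-finite F (Bounded-finite F n))

module _ {A : Set} where

  open import Data.Nat.Base using (_≤_)

  unpack : ∀ {n} → Bounded A n → List A
  unpack {zero}  _              = []
  unpack {suc n} nothing        = []
  unpack {suc n} (just (x , w)) = x ∷ unpack w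

  -- Lists longer than n are truncated.
  pack : ∀ n → List A → Bounded A n
  pack zero    _        = tt
  pack (suc n) []       = nothing
  pack (suc n) (x ∷ xs) = just (x , pack n xs)

  unpack-pack : ∀ n xs → length xs ≤ n → unpack (pack n xs) ≡ xs
  unpack-pack zero    []       _         = refl
  unpack-pack (suc n) []       _         = refl
  unpack-pack (suc n) (x ∷ xs) (s≤s len) = cong (x ∷_) (unpack-pack n xs len)

-- The machine keeps the string on the input tape.  Between reversals the head
-- of that tape rests on the blank to the left of the string (phase home) and
-- the work tape is blank.  The first list in a state is what remains to be cut
-- off, or in phase read the reversed window read so far; the second is the
-- current window with runs compressed; the bit tells whether the window is
-- the whole string.
data Phase : Set where
  start home read back cut ret rev : Phase

Phase-finite : Finite Phase
Phase-finite = start ∷ home ∷ read ∷ back ∷ cut ∷ ret ∷ rev ∷ [] , λ where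
  start → here refl
  home  → there (here refl)
  read  → there (there (here refl))
  back  → there (there (there (here refl)))
  cut   → there (there (there (there (here refl))))
  ret   → there (there (there (there (there (here refl)))))
  rev   → there (there (there (there (there (there (here refl))))))

-- The Turing machine and its simulation

module Machine (k L : ℕ) where

  open import Data.Nat.Base using (_+_; _*_; _≤_; _<_)

  Symbol : Set
  Symbol = Fin k ⊎ Mark

  Symbol-finite : Finite Symbol
  Symbol-finite = ⊎-finite (Fin-finite k) (tally ∷ end ∷ [] , λ { tally → here refl ; end → there (here refl) })

  Window : Set
  Window = Bounded (Fin k) L

  State : Set
  State = Phase × Window × Window × Bool

  ⌜_⌝ : Str k → Window
  ⌜_⌝ = pack L

  -- A full window still absorbs further copies of its last symbol, so reading never stops inside a
  -- block.
  extend : Str k → Fin k → Maybe (Str k)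
  extend rc x with rc | length rc <? L
  ... | []    | yes _ = just (x ∷ [])
  ... | []    | no  _ = nothing
  ... | y ∷ r | l with x Fin.≟ y | l
  ...   | yes _ | _     = just (y ∷ r)
  ...   | no  _ | yes _ = just (x ∷ y ∷ r)
  ...   | no  _ | no  _ = nothing

  carries : Fin k → Maybe Symbol → Bool
  carries x (just (inj₁ y)) with x Fin.≟ y
  ... | yes _ = true
  ... | no  _ = false
  carries x _ = false

  Action : Set
  Action = Maybe (State × Vec (Maybe Symbol × Move) 3)

  module _ (s o b : Maybe Symbol) where

    -- The pending list `take i c` names the blocks to cut off; the window stored beside it is
    -- already the one after the reversal, as `c` alone determines it.
    homeAction : Maybe ℕ → Str k → Bool → Action
    homeAction (just i) c f =
      just ((cut , ⌜ take i c ⌝ , ⌜ compress (reversePrefix i c) ⌝ , f) , (s , right) ∷ (o , stay) ∷ (b , stay) ∷ [])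
    homeAction nothing  c false =
      just ((read , ⌜ [] ⌝ , ⌜ [] ⌝ , false) , (s , right) ∷ (o , stay) ∷ (b , stay) ∷ [])
    homeAction nothing  c true  = nothing

    stopReading : Str k → Bool → Action
    stopReading rc f = just ((back , ⌜ [] ⌝ , ⌜ reverse rc ⌝ , f) , (s , left) ∷ (o , stay) ∷ (b , stay) ∷ [])

    extendAction : Str k → Maybe (Str k) → Action
    extendAction rc (just rc′) = just ((read , ⌜ rc′ ⌝ , ⌜ [] ⌝ , false) , (s , right) ∷ (o , stay) ∷ (b , stay) ∷ [])
    extendAction rc nothing    = stopReading rc false

    readAction : Str k → Maybe Symbol → Action
    readAction rc nothing         = stopReading rc true
    readAction rc (just (inj₁ x)) = extendAction rc (extend rc x)
    readAction rc (just (inj₂ _)) = nothing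

    backAction : Window → Bool → Maybe Symbol → Action
    backAction c f nothing  = just ((home , ⌜ [] ⌝ , c , f) , (s , stay) ∷ (o , stay) ∷ (b , stay) ∷ [])
    backAction c f (just _) = just ((back , ⌜ [] ⌝ , c , f) , (s , left) ∷ (o , stay) ∷ (b , stay) ∷ [])

    -- Every symbol passed is copied to the work tape and answered by one tally, so the unary index
    -- in the uncompressed string arises without being computed.
    runAction : Fin k → Str k → Window → Bool → Bool → Action
    runAction x p c f true  =
      just ((cut , ⌜ x ∷ p ⌝ , c , f) , (s , right) ∷ (just (inj₂ tally) , right) ∷ (s , right) ∷ [])
    runAction x p c f false =
      just ((cut , ⌜ p ⌝ , c , f) , (s , stay) ∷ (o , stay) ∷ (b , stay) ∷ [])

    cutAction : Str k → Window → Bool → Action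
    cutAction []      c f = just ((ret , ⌜ [] ⌝ , c , f) , (s , left) ∷ (just (inj₂ end) , right) ∷ (b , stay) ∷ [])
    cutAction (x ∷ p) c f = runAction x p c f (carries x s)

    retAction : Window → Bool → Maybe Symbol → Action
    retAction c f nothing  = just ((rev , ⌜ [] ⌝ , c , f) , (s , right) ∷ (o , stay) ∷ (b , left) ∷ [])
    retAction c f (just _) = just ((ret , ⌜ [] ⌝ , c , f) , (s , left) ∷ (o , stay) ∷ (b , stay) ∷ [])

    -- The work tape is consumed from its end while the input tape is overwritten from its
    -- beginning, which reverses the prefix and leaves the work tape blank.
    revAction : Window → Bool → Maybe Symbol → Action
    revAction c f nothing  = just ((back , ⌜ [] ⌝ , c , f) , (s , left) ∷ (o , stay) ∷ (b , stay) ∷ [])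
    revAction c f (just _) = just ((rev , ⌜ [] ⌝ , c , f) , (b , right) ∷ (o , stay) ∷ (nothing , left) ∷ [])

  transition : State → Vec (Maybe Symbol) 3 → Action
  transition (start , p , c , f) (s ∷ o ∷ b ∷ []) =
    just ((home , ⌜ [] ⌝ , ⌜ [] ⌝ , false) , (s , left) ∷ (o , stay) ∷ (b , stay) ∷ [])
  transition (home  , p , c , f) (s ∷ o ∷ b ∷ []) = homeAction s o b (nextFlip (unpack c)) (unpack c) f
  transition (read  , p , c , f) (s ∷ o ∷ b ∷ []) = readAction s o b (unpack p) s
  transition (back  , p , c , f) (s ∷ o ∷ b ∷ []) = backAction s o b c f s
  transition (cut   , p , c , f) (s ∷ o ∷ b ∷ []) = cutAction s o b (unpack p) c f
  transition (ret   , p , c , f) (s ∷ o ∷ b ∷ []) = retAction s o b c f s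
  transition (rev   , p , c , f) (s ∷ o ∷ b ∷ []) = revAction s o b c f b

  machine : TM (Fin k) Mark
  machine = record
    { Γ         = Symbol
    ; Γ-finite  = Symbol-finite
    ; inSymbol  = mk↣ inj₁-injective
    ; outSymbol = mk↣ inj₂-injective
    ; workTapes = 1
    ; Q         = State
    ; Q-finite  = ×-finite Phase-finite (×-finite W (×-finite W Bool-finite))
    ; start     = start , ⌜ [] ⌝ , ⌜ [] ⌝ , false
    ; δ         = transition
    }
    where W = Bounded-finite (Fin-finite k) L

  open Execution machine public

  -- Partial runs

  data Steps : Config → ℕ → Config → Set where
    []  : ∀ {c} → Steps c 0 c
    _∷_ : ∀ {c c′ c″ n} → step c ≡ just c′ → Steps c′ n c″ → Steps c (suc n) c″

  _++ˢ_ : ∀ {c c′ c″ m n} → Steps c m c′ → Steps c′ n c″ → Steps c (m + n) c″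
  []      ++ˢ s′ = s′
  (e ∷ s) ++ˢ s′ = e ∷ (s ++ˢ s′)

  steps-run : ∀ {c c′ n} → Steps c n c′ → step c′ ≡ nothing → Run c n c′
  steps-run []      h = halt h
  steps-run (e ∷ s) h = next e (steps-run s h)

  infix 4 _⟿[_]_

  _⟿[_]_ : Config → ℕ → (Config → Set) → Set
  c ⟿[ N ] P = ∃₂ λ n c′ → n ≤ N × Steps c n c′ × P c′

  ⟿-done : ∀ {c P} → P c → c ⟿[ 0 ] P
  ⟿-done p = 0 , _ , z≤n , [] , p

  ⟿-bind : ∀ {c M N} {P Q : Config → Set} → c ⟿[ M ] P → (∀ {c′} → P c′ → c′ ⟿[ N ] Q) → c ⟿[ M + N ] Q
  ⟿-bind (m , _ , m≤ , s , p) f with n , c″ , n≤ , s′ , q ← f p =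
    m + n , c″ , +-mono-≤ m≤ n≤ , s ++ˢ s′ , q

  ⟿-weaken : ∀ {c M N P} → M ≤ N → c ⟿[ M ] P → c ⟿[ N ] P
  ⟿-weaken M≤N (m , c′ , m≤ , r) = m , c′ , ≤-trans m≤ M≤N , r

  -- Tape contents

  Cells : Set
  Cells = List (Maybe Symbol)

  cells : Str k → Cells
  cells = map (just ∘ inj₁)

  blanks : ℕ → Cells
  blanks b = replicate b nothing

  focus : Cells → Cells → Tape Symbol
  focus ls []       = tape ls nothing []
  focus ls (c ∷ rs) = tape ls c rs

  -- The string p ʳ++ t is written, with the head on the first cell of t.
  data Reads (p t : Str k) : Tape Symbol → Set where
    reads : ∀ b → Reads p t (focus (cells p ++ nothing ∷ []) (cells t ++ blanks b))

  -- Visited blanks remain in the lists of a tape, so the number of trailing ones is left open. On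
  -- the left there is only the blank under the head, which is never passed.
  data Home (t : Str k) : Tape Symbol → Set where
    atHome : ∀ b → Home t (tape [] nothing (cells t ++ blanks b))

  -- As Reads, but with the head on the first cell of p.
  Leftwards : Str k → Str k → Tape Symbol → Set
  Leftwards []      t = Home t
  Leftwards (x ∷ p) t = Reads p (x ∷ t)

  data Pushed (p : Str k) : Tape Symbol → Set where
    pushed : ∀ b → Pushed p (tape (cells p) nothing (blanks b))

  data Pops : Str k → Tape Symbol → Set where
    empty : ∀ b → Pops [] (tape [] nothing (blanks b))
    top   : ∀ x p b → Pops (x ∷ p) (tape (cells p) (just (inj₁ x)) (blanks b))

  headCell : Str k → Maybe Symbol
  headCell []      = nothing
  headCell (x ∷ _) = just (inj₁ x)

  output : List Mark → Tape Symbol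
  output ro = tape (map (just ∘ inj₂) ro) nothing []

  reads-current : ∀ {p t T} → Reads p t T → current T ≡ headCell t
  reads-current {t = []}    (reads zero)    = refl
  reads-current {t = []}    (reads (suc b)) = refl
  reads-current {t = x ∷ t} (reads b)       = refl

  move-right : ∀ ls c rs → move right (tape ls c rs) ≡ focus (c ∷ ls) rs
  move-right ls c []       = refl
  move-right ls c (r ∷ rs) = refl

  reads-right : ∀ {p x y t T} → Reads p (x ∷ t) T → Reads (y ∷ p) t (act T (just (inj₁ y) , right))
  reads-right {p} {y = y} {t} (reads b)
    rewrite move-right (cells p ++ nothing ∷ []) (just (inj₁ y)) (cells t ++ blanks b) = reads b

  reads-left : ∀ {p t T} → Reads p t T → Leftwards p t (act T (headCell t , left))
  reads-left {[]}    {[]}    (reads zero)    = atHome 1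
  reads-left {[]}    {[]}    (reads (suc b)) = atHome (suc b)
  reads-left {[]}    {y ∷ t} (reads b)       = atHome b
  reads-left {x ∷ p} {[]}    (reads zero)    = reads 1
  reads-left {x ∷ p} {[]}    (reads (suc b)) = reads (suc b)
  reads-left {x ∷ p} {y ∷ t} (reads b)       = reads b

  home-right : ∀ {t T} → Home t T → Reads [] t (act T (nothing , right))
  home-right {t} (atHome b) rewrite move-right [] nothing (cells t ++ blanks b) = reads b

  pushed-right : ∀ {p x T} → Pushed p T → Pushed (x ∷ p) (act T (just (inj₁ x) , right))
  pushed-right (pushed zero)    = pushed zero
  pushed-right (pushed (suc b)) = pushed b

  pushed-left : ∀ {p T} → Pushed p T → Pops p (act T (nothing , left))
  pushed-left {[]}    (pushed b) = empty (suc b)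
  pushed-left {x ∷ p} (pushed b) = top x p (suc b)

  pops-left : ∀ {x p T} → Pops (x ∷ p) T → Pops p (act T (nothing , left))
  pops-left (top x []      b) = empty (suc b)
  pops-left (top x (y ∷ p) b) = top y p (suc b)

  pops-current : ∀ {p T} → Pops p T → current T ≡ headCell p
  pops-current (empty b)   = refl
  pops-current (top x p b) = refl

  data Conf (q : State) (σ β : Tape Symbol → Set) (ro : List Mark) : Config → Set where
    conf : ∀ {S B} → σ S → β B → Conf q σ β ro (q , S ∷ output ro ∷ B ∷ [])

  step-transition : ∀ {q ts q′ as} → transition q (Vec.map current ts) ≡ just (q′ , as) →
                    step (q , ts) ≡ just (q′ , Vec.zipWith act ts as)
  step-transition {q} {ts} eq with transition q (Vec.map current ts)
  step-transition refl | just _ = refl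

  step-halts : ∀ {q ts} → transition q (Vec.map current ts) ≡ nothing → step (q , ts) ≡ nothing
  step-halts {q} {ts} eq with transition q (Vec.map current ts)
  step-halts refl | nothing = refl

  one : ∀ {q ts q′ as P} → transition q (Vec.map current ts) ≡ just (q′ , as) →
        P (q′ , Vec.zipWith act ts as) → (q , ts) ⟿[ 1 ] P
  one {q} {ts} eq p = 1 , _ , ≤-refl , step-transition {q} {ts} eq ∷ [] , p

  unpack-⌜⌝ : ∀ c → length c ≤ L → unpack ⌜ c ⌝ ≡ c
  unpack-⌜⌝ = unpack-pack L

  -- Phases back and ret

  back-loop : ∀ p {t c f ro β x} → Conf (back , ⌜ [] ⌝ , c , f) (Leftwards p t) β ro x →
              x ⟿[ length p + 1 ] Conf (home , ⌜ [] ⌝ , c , f) (Home (p ʳ++ t)) β ro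
  back-loop []      (conf (atHome b) β) = one refl (conf (atHome b) β)
  back-loop (x ∷ p) {t} {c} {f} {ro} (conf {S} {B} σ β) = ⟿-bind
    (one (cong (λ z → backAction z nothing (current B) c f z) (reads-current σ)) (conf (reads-left σ) β))
    (back-loop p)

  ret-loop : ∀ p {t c f ro β x} → Conf (ret , ⌜ [] ⌝ , c , f) (Leftwards p t) β ro x →
             x ⟿[ length p + 0 ] Conf (ret , ⌜ [] ⌝ , c , f) (Home (p ʳ++ t)) β ro
  ret-loop []      x = ⟿-done x
  ret-loop (x ∷ p) {t} {c} {f} {ro} (conf {S} {B} σ β) = ⟿-bind
    (one (cong (λ z → retAction z nothing (current B) c f z) (reads-current σ)) (conf (reads-left σ) β))
    (ret-loop p)

  ret-rev : ∀ {t p c f ro x} → Conf (ret , ⌜ [] ⌝ , c , f) (Home t) (Pushed p) ro x →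
            x ⟿[ 1 ] Conf (rev , ⌜ [] ⌝ , c , f) (Reads [] t) (Pops p) ro
  ret-rev (conf (atHome b) (pushed b′)) = one refl (conf (home-right (atHome b)) (pushed-left (pushed b′)))

  -- Of the old prefix `a` only the length matters, its symbols being overwritten by those of `r`.
  rev-loop : ∀ r a {p v c f ro x} → length a ≡ length r →
             Conf (rev , ⌜ [] ⌝ , c , f) (Reads p (a ++ v)) (Pops r) ro x →
             x ⟿[ length r + 1 ] Conf (back , ⌜ [] ⌝ , c , f) (Leftwards (r ʳ++ p) v) (Pushed []) ro
  rev-loop []      []      {v = v} {c} {f} _ (conf {S} {B} σ β@(empty b)) =
    one (cong (λ s → revAction s nothing nothing c f nothing) (reads-current σ)) (conf (reads-left σ) (pushed b))
  rev-loop (y ∷ r) (x ∷ a) {c = c} {f} eq (conf {S} {B} σ β) = ⟿-bind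
    (one (cong (λ b → revAction (current S) nothing b c f b) (pops-current β)) (conf (reads-right σ) (pops-left β)))
    (rev-loop r a (suc-injective eq))

  -- Phase cut

  carries-refl : ∀ x → carries x (just (inj₁ x)) ≡ true
  carries-refl x with x Fin.≟ x
  ... | yes _  = refl
  ... | no x≢x = contradiction refl x≢x

  -- An expansion begins with the first symbol of the string expanded, and that of `r` differs from
  -- `x`: once a run is exhausted, the cell under the head shows it.
  carries-next : ∀ {x r t} → NoStutter (x ∷ r) → Expands r t → carries x (headCell t) ≡ false
  carries-next         _         []         = refl
  carries-next {x} (x≢y ∷ _) (keep y e) with x Fin.≟ y
  ... | yes x≡y = contradiction x≡y x≢y
  ... | no  _   = refl
  carries-next {x} (x≢y ∷ _) (dup y e) with x Fin.≟ y
  ... | yes x≡y = contradiction x≡y x≢y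
  ... | no  _   = refl

  tallies : ℕ → List Mark → List Mark
  tallies n ro = replicate n tally ʳ++ ro

  cut-run : ∀ {x p r t c f pb ro K} → length (x ∷ p) ≤ L →
            Conf (cut , ⌜ x ∷ p ⌝ , c , f) (Reads r (x ∷ t)) (Pushed pb) ro K →
            K ⟿[ 1 ] Conf (cut , ⌜ x ∷ p ⌝ , c , f) (Reads (x ∷ r) t) (Pushed (x ∷ pb)) (tally ∷ ro)
  cut-run {x} {p} {c = c} {f} len (conf {S} {B} σ β) = one eq (conf (reads-right σ) (pushed-right β))
    where
    eq : cutAction (current S) nothing (current B) (unpack ⌜ x ∷ p ⌝) c f ≡
         just ((cut , ⌜ x ∷ p ⌝ , c , f) ,
               (just (inj₁ x) , right) ∷ (just (inj₂ tally) , right) ∷ (just (inj₁ x) , right) ∷ [])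
    eq rewrite unpack-⌜⌝ (x ∷ p) len | reads-current σ | carries-refl x = refl

  cut-next : ∀ {x p q r t c f pb ro K} → length (x ∷ p) ≤ L → NoStutter (x ∷ p ++ q) → Expands (p ++ q) t →
             Conf (cut , ⌜ x ∷ p ⌝ , c , f) (Reads r t) (Pushed pb) ro K →
             K ⟿[ 1 ] Conf (cut , ⌜ p ⌝ , c , f) (Reads r t) (Pushed pb) ro
  cut-next {x} {p} {t = t} {c} {f} len N e (conf {S} {B} σ β) = one eq (conf σ β)
    where
    eq : cutAction (current S) nothing (current B) (unpack ⌜ x ∷ p ⌝) c f ≡
         just ((cut , ⌜ p ⌝ , c , f) , (current S , stay) ∷ (nothing , stay) ∷ (current B , stay) ∷ [])
    eq rewrite unpack-⌜⌝ (x ∷ p) len | cong (carries x) (reads-current σ) | carries-next N e = refl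

  cut-loop : ∀ p {q t} → length p ≤ L → NoStutter (p ++ q) → Expands (p ++ q) t →
             ∃₂ λ u v → t ≡ u ++ v × Expands p u × Expands q v ×
             (∀ {r c f pb ro K} → Conf (cut , ⌜ p ⌝ , c , f) (Reads r t) (Pushed pb) ro K →
              K ⟿[ 2 * length u ] Conf (cut , ⌜ [] ⌝ , c , f) (Reads (u ʳ++ r) v) (Pushed (u ʳ++ pb)) (tallies (length u) ro))
  cut-loop []      len N e = [] , _ , refl , [] , e , ⟿-done
  cut-loop (x ∷ p) {q} len N (keep x e)
    with u , v , refl , e₁ , e₂ , go ← cut-loop p (≤-trans (n≤1+n _) len) (Linked.tail N) e =
    -- `keep` is the last copy of its run: one step passes it and another drops the block from the
    -- pending list. A `dup` needs only the former, so two steps per symbol suffice.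
    x ∷ u , v , refl , keep x e₁ , e₂ , λ K →
      ⟿-weaken (≤-reflexive (sym (*-suc 2 (length u)))) (⟿-bind (cut-run len K) λ K → ⟿-bind (cut-next {q = q} len N e K) go)
  cut-loop (x ∷ p) len N (dup x e)
    with u , v , refl , e₁ , e₂ , go ← cut-loop (x ∷ p) len N e =
    x ∷ u , v , refl , dup x e₁ , e₂ , λ K →
      ⟿-weaken (≤-trans (n≤1+n _) (≤-reflexive (sym (*-suc 2 (length u))))) (⟿-bind (cut-run len K) go)

  cut-end : ∀ {r v c f pb ro K} →
            Conf (cut , ⌜ [] ⌝ , c , f) (Reads r v) (Pushed pb) ro K →
            K ⟿[ 1 ] Conf (ret , ⌜ [] ⌝ , c , f) (Leftwards r v) (Pushed pb) (end ∷ ro)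
  cut-end {v = v} {c} {f} (conf {S} {B} σ β) = one eq (conf (reads-left σ) β)
    where
    eq : cutAction (current S) nothing (current B) (unpack ⌜ [] ⌝) c f ≡
         just ((ret , ⌜ [] ⌝ , c , f) , (headCell v , left) ∷ (just (inj₂ end) , right) ∷ (current B , stay) ∷ [])
    eq rewrite unpack-⌜⌝ [] z≤n | reads-current σ = refl

  home-cut : ∀ {c f s ro i K} → length c ≤ L → nextFlip c ≡ just i →
             Conf (home , ⌜ [] ⌝ , ⌜ c ⌝ , f) (Home s) (Pushed []) ro K →
             K ⟿[ 1 ] Conf (cut , ⌜ take i c ⌝ , ⌜ compress (reversePrefix i c) ⌝ , f) (Reads [] s) (Pushed []) ro
  home-cut {c} {f} {i = i} len next≡ (conf {S} {B} (atHome b) β) = one eq (conf (home-right (atHome b)) β)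
    where
    eq : homeAction nothing nothing (current B) (nextFlip (unpack ⌜ c ⌝)) (unpack ⌜ c ⌝) f ≡
         just ((cut , ⌜ take i c ⌝ , ⌜ compress (reversePrefix i c) ⌝ , f) ,
               (nothing , right) ∷ (nothing , stay) ∷ (current B , stay) ∷ [])
    eq rewrite unpack-⌜⌝ c len | next≡ = refl

  AtHome : Str k → Bool → Str k → List Mark → Config → Set
  AtHome c f s = Conf (home , ⌜ [] ⌝ , ⌜ c ⌝ , f) (Home s) (Pushed [])

  take++drop++ : ∀ i (c e : Str k) → c ++ e ≡ take i c ++ (drop i c ++ e)
  take++drop++ i c e = trans (cong (_++ e) (sym (take++drop≡id i c))) (++-assoc (take i c) _ _)

  -- The coefficient 5 is two steps per symbol of the prefix for cutting and one each for returning,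
  -- rewriting and walking home; the constant 5 collects the phase changes.
  home-flip : ∀ {c f e s i} → length c ≤ L → nextFlip c ≡ just i →
              NoStutter (c ++ e) → Expands (c ++ e) s →
              ∃₂ λ u v → s ≡ u ++ v × Expands (take i c) u × Expands (drop i c ++ e) v ×
              (∀ {ro K} → AtHome c f s ro K →
               K ⟿[ 5 * length s + 5 ]
                 AtHome (compress (reversePrefix i c)) f (u ʳ++ v) (end ∷ tallies (length u) ro))
  home-flip {c} {f} {e} {i = i} len next≡ N E
    with u , v , refl , e₁ , e₂ , go ←
      cut-loop (take i c) (≤-trans (≤-reflexive (length-take i c)) (≤-trans (m⊓n≤n i _) len))
               (subst NoStutter (take++drop++ i c e) N) (subst (λ t → Expands t _) (take++drop++ i c e) E) =
    u , v , refl , e₁ , e₂ , λ K →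
      ⟿-weaken (bound u v)
       (⟿-bind (home-cut len next≡ K) λ K →
        ⟿-bind (go K) λ K →
        ⟿-bind (cut-end K) λ K →
        ⟿-bind (ret-loop (reverse u) K) λ K →
        ⟿-bind (ret-rev K) λ K →
        ⟿-bind (rev-loop (reverse u) u (sym (length-reverse u)) (unreverse u v K)) λ K →
        subst (λ t → _ ⟿[ _ ] AtHome _ f t _) (rereverse u v) (back-loop (reverse u ʳ++ []) K))
    where
    unreverse : ∀ u v {q β ro K} → Conf q (Reads [] (reverse u ʳ++ v)) β ro K → Conf q (Reads [] (u ++ v)) β ro K
    unreverse u v {q} {β} {ro} {K} = subst (λ t → Conf q (Reads [] t) β ro K) (ʳ++-ʳ++ u)
    rereverse : ∀ (u v : Str k) → (reverse u ʳ++ []) ʳ++ v ≡ u ʳ++ v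
    rereverse u v = cong (_ʳ++ v) (trans (ʳ++-ʳ++ u) (++-identityʳ u))
    bound : ∀ (u v : Str k) → 1 + (2 * length u + (1 + (length (reverse u) + 0 + (1 + (length (reverse u) + 1
              + (length (reverse u ʳ++ []) + 1)))))) ≤ 5 * length (u ++ v) + 5
    bound u v rewrite cong length (trans (ʳ++-ʳ++ u {[]} {[]}) (++-identityʳ u)) | length-reverse u | length-++ u {v} =
      ≤-trans (≤-reflexive (count (length u)))
              (+-monoˡ-≤ 5 (*-monoʳ-≤ 5 (m≤m+n (length u) (length v))))
      where
      count : ∀ n → 1 + (2 * n + (1 + (n + 0 + (1 + (n + 1 + (n + 1)))))) ≡ 5 * n + 5
      count = solve-∀

  -- Phase read

  data Extended (x : Fin k) (rc : Str k) : Maybe (Str k) → Set where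
    more : ∀ {rc′} → length rc′ ≤ L → NoStutter rc′ →
           (∀ {p} → Expands rc p → Expands rc′ (x ∷ p)) → Extended x rc (just rc′)
    full : ∀ {y r} → rc ≡ y ∷ r → length rc ≡ L → x ≢ y → Extended x rc nothing

  extended : ∀ x {rc} → 1 ≤ L → length rc ≤ L → NoStutter rc → Extended x rc (extend rc x)
  extended x {[]}    1≤L len N with 0 <? L
  ... | yes 0<L = more 0<L [-] (keep x)
  ... | no  0≮L = contradiction 1≤L 0≮L
  extended x {y ∷ r} 1≤L len N with x Fin.≟ y | length (y ∷ r) <? L
  ... | yes refl | _       = more len N (dup x)
  ... | no  x≢y  | yes l<L = more l<L (x≢y ∷ N) (keep x)
  ... | no  x≢y  | no  l≮L = full refl (≤-antisym len (≮⇒≥ l≮L)) x≢y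

  noStutter-ʳ++ : ∀ {x} r {e} → NoStutter {k} (x ∷ r) → NoStutter (x ∷ e) → NoStutter (r ʳ++ x ∷ e)
  noStutter-ʳ++ []      _         N′ = N′
  noStutter-ʳ++ (y ∷ r) (x≢y ∷ N) N′ = noStutter-ʳ++ r N ((x≢y ∘ sym) ∷ N′)

  noStutter-reverse : ∀ {r} → NoStutter {k} r → NoStutter (reverse r)
  noStutter-reverse {[]}    N = []
  noStutter-reverse {x ∷ r} N = noStutter-ʳ++ r N [-]

  expands-head : ∀ {t x s} → Expands {k} t (x ∷ s) → ∃[ t′ ] t ≡ x ∷ t′
  expands-head (keep x e) = _ , refl
  expands-head (dup x e)  = _ , refl

  -- Only `c` and `f` are known to the machine; `e`, the compressed rest, exists in the analysis
  -- alone.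
  record Window-of (s : Str k) : Set where
    field
      c e  : Str k
      f    : Bool
      expands   : Expands (c ++ e) s
      noStutter : NoStutter (c ++ e)
      bounded   : length c ≤ L
      whole     : (f ≡ true × e ≡ []) ⊎ (f ≡ false × length c ≡ L)

  open Window-of

  noStutter-full : ∀ {x y r t} → x ≢ y → NoStutter (y ∷ r) → NoStutter {k} (r ʳ++ y ∷ compress (x ∷ t))
  noStutter-full {x} {y} {r} {t} x≢y N
    with compress (x ∷ t) | expands-head (expands-compress (x ∷ t)) | noStutter-compress (x ∷ t)
  ... | .(x ∷ t′) | t′ , refl | N′ = noStutter-ʳ++ r N ((x≢y ∘ sym) ∷ N′)

  read-loop : ∀ t {p rc} → 1 ≤ L → length rc ≤ L → NoStutter rc → Expands rc p →
              Σ (Window-of (p ʳ++ t)) λ w → ∃₂ λ p′ t′ → p′ ʳ++ t′ ≡ p ʳ++ t ×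
              (∀ {c β ro K} → Conf (read , ⌜ rc ⌝ , c , false) (Reads p t) β ro K →
               K ⟿[ length t + 1 ] Conf (back , ⌜ [] ⌝ , ⌜ Window-of.c w ⌝ , f w) (Leftwards p′ t′) β ro)
  read-loop [] {p} {rc} 1≤L len N E =
    record { c = reverse rc ; e = [] ; f = true
           ; expands   = subst (λ t → Expands t (reverse p)) (sym (++-identityʳ _)) (expands-ʳ++ E [])
           ; noStutter = subst NoStutter (sym (++-identityʳ _)) (noStutter-reverse N)
           ; bounded   = ≤-trans (≤-reflexive (length-reverse rc)) len
           ; whole     = inj₁ (refl , refl) } ,
    p , [] , refl , λ { (conf {S} {B} σ β) → one (eq (current B) (reads-current σ)) (conf (reads-left σ) β) }
    where
    eq : ∀ b {s} → s ≡ nothing → readAction s nothing b (unpack ⌜ rc ⌝) s ≡ stopReading nothing nothing b rc true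
    eq b refl rewrite unpack-⌜⌝ rc len = refl
  read-loop (x ∷ t) {p} {rc} 1≤L len N E with extend rc x in ext | extended x 1≤L len N
  ... | just rc′ | more len′ N′ E′ with w , p′ , t′ , eq′ , go ← read-loop t 1≤L len′ N′ (E′ E) =
    w , p′ , t′ , eq′ , λ { (conf {S} {B} σ β) → ⟿-bind
      (one (eq (current B) (reads-current σ)) (conf (reads-right σ) β)) (go {⌜ [] ⌝}) }
    where
    eq : ∀ b {s} → s ≡ just (inj₁ x) → readAction s nothing b (unpack ⌜ rc ⌝) s ≡
         extendAction (just (inj₁ x)) nothing b rc (just rc′)
    eq b refl rewrite unpack-⌜⌝ rc len | ext = refl
  ... | nothing | full {y} {r} refl l≡L x≢y =
    record { c = reverse rc ; e = compress (x ∷ t) ; f = false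
           ; expands   = subst (λ t′ → Expands t′ (p ʳ++ x ∷ t)) (ʳ++-defn rc)
                           (expands-ʳ++ E (expands-compress (x ∷ t)))
           ; noStutter = subst NoStutter (ʳ++-defn rc) (noStutter-full {t = t} x≢y N)
           ; bounded   = ≤-trans (≤-reflexive (length-reverse rc)) len
           ; whole     = inj₂ (refl , trans (length-reverse rc) l≡L) } ,
    p , x ∷ t , refl , λ { (conf {S} {B} σ β) →
      ⟿-weaken (m≤n+m 1 (suc (length t))) (one (eq (current B) (reads-current σ)) (conf (reads-left σ) β)) }
    where
    eq : ∀ b {s} → s ≡ just (inj₁ x) → readAction s nothing b (unpack ⌜ rc ⌝) s ≡
         stopReading (just (inj₁ x)) nothing b rc false
    eq b refl rewrite unpack-⌜⌝ rc len | ext = refl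

  home-read : ∀ {c s ro K} → length c ≤ L → nextFlip c ≡ nothing → AtHome c false s ro K →
              K ⟿[ 1 ] Conf (read , ⌜ [] ⌝ , ⌜ [] ⌝ , false) (Reads [] s) (Pushed []) ro
  home-read {c} len next≡ (conf {S} {B} (atHome b) β) = one eq (conf (home-right (atHome b)) β)
    where
    eq : homeAction nothing nothing (current B) (nextFlip (unpack ⌜ c ⌝)) (unpack ⌜ c ⌝) false ≡
         just ((read , ⌜ [] ⌝ , ⌜ [] ⌝ , false) , (nothing , right) ∷ (nothing , stay) ∷ (current B , stay) ∷ [])
    eq rewrite unpack-⌜⌝ c len | next≡ = refl

  read-window : ∀ s {c₀} → 1 ≤ L → length c₀ ≤ L → nextFlip c₀ ≡ nothing →
                Σ (Window-of s) λ w → ∀ {ro K} → AtHome c₀ false s ro K →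
                K ⟿[ 2 * length s + 3 ] AtHome (Window-of.c w) (f w) s ro
  read-window s 1≤L len₀ next≡ with w , p′ , t′ , eq , go ← read-loop s {[]} {[]} 1≤L z≤n [] [] =
    w , λ K → ⟿-weaken (bound p′ t′ eq)
      (⟿-bind (home-read len₀ next≡ K) λ K → ⟿-bind (go K) λ K →
       subst (λ t → _ ⟿[ _ ] AtHome _ _ t _) eq (back-loop p′ K))
    where
    bound : ∀ p′ t′ → p′ ʳ++ t′ ≡ s → 1 + (length s + 1 + (length p′ + 1)) ≤ 2 * length s + 3
    bound p′ t′ refl = ≤-trans
      (+-monoʳ-≤ 1 (+-monoʳ-≤ (length s + 1) (+-monoˡ-≤ 1 (≤-trans (m≤m+n _ _) (≤-reflexive (sym (length-ʳ++ p′)))))))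
      (≤-reflexive (count (length s)))
      where
      count : ∀ n → 1 + (n + 1 + (n + 1)) ≡ 2 * n + 3
      count = solve-∀

  home-halts : ∀ {c s ro K} → length c ≤ L → nextFlip c ≡ nothing → AtHome c true s ro K → step K ≡ nothing
  home-halts {c} len next≡ (conf {S} {B} (atHome b) β) = step-halts {home , ⌜ [] ⌝ , ⌜ c ⌝ , true} eq
    where
    eq : homeAction nothing nothing (current B) (nextFlip (unpack ⌜ c ⌝)) (unpack ⌜ c ⌝) true ≡ nothing
    eq rewrite unpack-⌜⌝ c len | next≡ = refl

  start-home : ∀ s → initial s ⟿[ 1 ] AtHome [] false s []
  start-home []      = one refl (conf (atHome 1) (pushed 0))
  start-home (x ∷ s) = one refl (subst (λ r → Conf _ (Home (x ∷ s)) (Pushed []) [] (_ , tape [] nothing (just (inj₁ x) ∷ r) ∷ _))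
    (trans (++-identityʳ _) (map-∘ s)) (conf (atHome 0) (pushed 0)))

  -- Sorting a window

  flipTime : ℕ → ℕ
  flipTime l = 5 * l + 5

  -- `length-e` keeps the unseen rest from growing, so that blocks lost by the window are lost by
  -- the whole string.
  record Descent (n : ℕ) (c e s : Str k) (f : Bool) : Set where
    field
      is        : List ℕ
      s′ c′ e′  : Str k
      path      : s ⟶⟨ is ⟩ s′
      count     : length is ≤ n
      length≡   : length s′ ≡ length s
      bounded   : length c′ ≤ L
      finished  : nextFlip c′ ≡ nothing
      sorted    : Sorted c′
      noStutter : NoStutter (c′ ++ e′)
      expands   : Expands (c′ ++ e′) s′
      length-e  : length e′ ≤ length e
      run       : ∀ {ro K} → AtHome c f s ro K →
                  K ⟿[ n * flipTime (length s) ] AtHome c′ f s′ (encode is ʳ++ ro)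

  encode-ʳ++ : ∀ i is ro → encode (i ∷ is) ʳ++ ro ≡ encode is ʳ++ (end ∷ tallies i ro)
  encode-ʳ++ i is ro = trans (++-ʳ++ (replicate i tally ++ end ∷ [])) (cong (encode is ʳ++_) (++-ʳ++ (replicate i tally)))

  -- After a reversal the last block of the window may equal the first symbol of `e`. The machine
  -- cannot see this, so the repetition is deleted from `e`, and the window remains exactly the one
  -- computed in the control.
  descend : ∀ n {c e s f} → length c ≤ L → Sortable n c → NoStutter (c ++ e) → Expands (c ++ e) s →
            Descent n c e s f
  descend n {c} {e} {s} {f} len S N E with progress n c S
  ... | inj₁ (next≡ , Sc) = record
    { is = [] ; s′ = s ; c′ = c ; e′ = e ; path = done ; count = z≤n ; length≡ = refl ; bounded = len
    ; finished = next≡ ; sorted = Sc ; noStutter = N ; expands = E ; length-e = ≤-refl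
    ; run = λ K → ⟿-weaken z≤n (⟿-done K) }
  ... | inj₂ (suc i , m , next≡ , refl , _ , 1≤c , S′)
    with u , v , refl , Eu , Ev , go ← home-flip {c} {f} {e} {s} {suc i} len next≡ N E
    with e₁ , N₁ , E₁ , l₁ ← noStutter-join (compress (reversePrefix (suc i) c)) e
                               (noStutter-compress (reversePrefix (suc i) c)) (noStutter-++⁻ʳ c N) = record
    { is = length u ∷ D.is ; s′ = D.s′ ; c′ = D.c′ ; e′ = D.e′
    ; path = flip (1≤u c 1≤c Eu) (≤-trans (m≤m+n _ _) (≤-reflexive (sym (length-++ u))))
                  (subst (_⟶⟨ D.is ⟩ D.s′) (sym (reversePrefix-ʳ++ u v)) D.path)
    ; count = s≤s D.count
    ; length≡ = trans D.length≡ length-u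
    ; bounded = D.bounded ; finished = D.finished ; sorted = D.sorted ; noStutter = D.noStutter ; expands = D.expands
    ; length-e = ≤-trans D.length-e l₁
    ; run = λ {ro} K → ⟿-bind (go K) λ K →
        subst (λ ro → _ ⟿[ _ ] AtHome D.c′ f D.s′ ro) (sym (encode-ʳ++ (length u) D.is ro))
          (subst (λ l → _ ⟿[ m * flipTime l ] AtHome D.c′ f D.s′ (encode D.is ʳ++ (end ∷ tallies (length u) ro)))
            length-u (D.run K)) }
    where
    c₁ = compress (reversePrefix (suc i) c)

    1≤u : ∀ c {u} → 1 ≤ length c → Expands (take (suc i) c) u → 1 ≤ length u
    1≤u (_ ∷ _) _ E = ≤-trans (s≤s z≤n) (length-mono-≤ (expands-⊆ E))

    length-u : length (u ʳ++ v) ≡ length (u ++ v)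
    length-u = trans (length-ʳ++ u) (sym (length-++ u))

    flipped : take (suc i) c ʳ++ (drop (suc i) c ++ e) ≡ reversePrefix (suc i) c ++ e
    flipped = trans (ʳ++-defn (take (suc i) c)) (sym (++-assoc (reverse (take (suc i) c)) _ e))

    expands₁ : Expands (c₁ ++ e₁) (u ʳ++ v)
    expands₁ = expands-trans E₁ (expands-trans (expands-++ (expands-compress (reversePrefix (suc i) c)) (expands-refl e))
      (subst (λ t → Expands t (u ʳ++ v)) flipped (expands-ʳ++ Eu Ev)))

    module D = Descent (descend m {c₁} {e₁} {u ʳ++ v} {f}
      (≤-trans (length-compress (reversePrefix (suc i) c)) (≤-trans (≤-reflexive (length-reversePrefix (suc i) c)) len))
      S′ N₁ expands₁)

-- Rounds, approximation ratio and running time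

module Approximation (k q : ℕ) .⦃ k≢0 : NonZero k ⦄ .⦃ q≢0 : NonZero q ⦄ where

  open import Data.Nat.Base using (_+_; _*_; _^_; _≤_)

  -- `M` is the guaranteed loss of blocks per round, as up to k of the L blocks survive in a sorted
  -- window. The factor 12 is dictated by `ratio`, where the overhead is at most 12kn; `q` stands
  -- for the denominator of ε.
  M L : ℕ
  M = 12 * k * q
  L = k + M

  12k≤M : 12 * k ≤ M
  12k≤M = ≤-trans (≤-reflexive (sym (*-identityʳ (12 * k)))) (*-monoʳ-≤ (12 * k) (>-nonZero⁻¹ q))

  k≤M : k ≤ M
  k≤M = ≤-trans (m≤m+n k (11 * k)) 12k≤M

  1≤M : 1 ≤ M
  1≤M = ≤-trans (>-nonZero⁻¹ k) k≤M

  1≤L : 1 ≤ L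
  1≤L = ≤-trans 1≤M (m≤n+m M k)

  open Machine k L

  roundTime : ℕ → ℕ
  roundTime l = (2 * l + 3) + (L + 3 * k) * flipTime l

  Halted : List Mark → Config → Set
  Halted ro K = step K ≡ nothing × ∃ λ Q → ∃₂ λ S B → K ≡ (Q , S ∷ output ro ∷ B ∷ [])

  -- `count` is the amortised bound, multiplied by `M` to avoid division. Its additive term would
  -- spoil the ratio on strings with few blocks, hence the alternative in `optimal`.
  record Result (m : ℕ) (c s : Str k) : Set where
    field
      is      : List ℕ
      s′      : Str k
      path    : s ⟶⟨ is ⟩ s′
      sorted  : Sorted s′
      count   : length is * M ≤ blocks s * (M + 4 * k) + 3 * k * M
      optimal : (∀ n → Sortable n s → length is ≤ n) ⊎ L ≤ blocks s
      run     : ∀ {ro K} → AtHome c false s ro K → K ⟿[ suc m * roundTime (length s) ] Halted (encode is ʳ++ ro)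

  halted : ∀ {c s ro K} → length c ≤ L → nextFlip c ≡ nothing → AtHome c true s ro K → Halted ro K
  halted len next≡ K@(conf _ _) = home-halts len next≡ K , _ , _ , _ , refl

  -- Every round but the last removes at least `M` ≥ 1 blocks, so `m` serves both as recursion
  -- measure and as bound on the number of further rounds.
  rounds : ∀ m {c₀} s → length c₀ ≤ L → nextFlip c₀ ≡ nothing → blocks s ≤ m → Result m c₀ s
  rounds m {c₀} s len₀ next≡ bs≤m
    with read-window s {c₀} 1≤L len₀ next≡
  ... | record { c = c ; e = .[] ; f = .true ; expands = E ; noStutter = N ; bounded = len ; whole = inj₁ (refl , refl) } , go
    = lastRound (sorting-distance c)
    where
    bs≡ : blocks s ≡ length c
    bs≡ = trans (blocks≡length N E) (cong length (++-identityʳ c))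

    sorted-whole : ∀ {c′ e′ s′ : Str k} → length e′ ≤ 0 → Expands (c′ ++ e′) s′ → Sorted c′ → Sorted s′
    sorted-whole {e′ = []} _ E S = sorted-expands E (subst Sorted (sym (++-identityʳ _)) S)

    lastRound : ∃[ d ] Sortable d c × (∀ n → Sortable n c → d ≤ n) → Result m c₀ s
    lastRound (d , S , min) = record
      { is = D.is ; s′ = D.s′ ; path = D.path ; sorted = sorted-whole D.length-e D.expands D.sorted
      ; count = ≤-trans (*-monoˡ-≤ M (≤-trans D.count d≤)) (bound (blocks s))
      -- With an empty rest `c` arises from `s` by deleting symbols, so whatever number sorts `s`
      -- sorts `c` and is at least `d`.
      ; optimal = inj₁ λ n Sn → ≤-trans D.count (min n (sortable-⊆ n
                    (subst (_⊆ s) (++-identityʳ c) (expands-⊆ E)) Sn))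
      ; run = λ K → ⟿-weaken time (⟿-bind (go K) λ K → ⟿-bind (D.run K) λ K → ⟿-done (halted D.bounded D.finished K)) }
      where
      module D = Descent (descend d {c} {[]} {s} {true} len S N E)

      d≤ : d ≤ blocks s + 3 * k
      d≤ = subst (λ b → d ≤ b + 3 * k) (sym bs≡) (min _ (sortable-blocks c))

      bound : ∀ b → (b + 3 * k) * M ≤ b * (M + 4 * k) + 3 * k * M
      bound b = ≤-trans (≤-reflexive (*-distribʳ-+ M b (3 * k)))
                        (+-monoˡ-≤ (3 * k * M) (*-monoʳ-≤ b (m≤m+n M (4 * k))))

      time : 2 * length s + 3 + (d * flipTime (length s) + 0) ≤ suc m * roundTime (length s)
      time = ≤-trans
        (+-monoʳ-≤ (2 * length s + 3) (≤-trans (≤-reflexive (+-identityʳ _))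
          (*-monoˡ-≤ (flipTime (length s)) (≤-trans (min _ (sortable-blocks c)) (+-monoˡ-≤ (3 * k) len)))))
        (m≤m+n _ _)
  rounds m {c₀} s len₀ next≡ bs≤m
      | record { c = c ; e = e ; f = .false ; expands = E ; noStutter = N ; bounded = len ; whole = inj₂ (refl , c≡L) } , go
    = furtherRound m bs≤m
    where
    bs≡ : blocks s ≡ L + length e
    bs≡ = trans (blocks≡length N E) (trans (length-++ c) (cong (_+ length e) c≡L))

    module D = Descent (descend (L + 3 * k) {c} {e} {s} {false} len
      (subst (λ l → Sortable (l + 3 * k) c) c≡L (sortable-blocks c)) N E)

    bs′≤ : blocks D.s′ + M ≤ blocks s
    bs′≤ = begin
      blocks D.s′ + M                     ≡⟨ cong (_+ M) (trans (blocks≡length D.noStutter D.expands) (length-++ D.c′)) ⟩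
      length D.c′ + length D.e′ + M       ≤⟨ +-monoˡ-≤ M (+-mono-≤ c′≤k D.length-e) ⟩
      k + length e + M                    ≡⟨ count k (length e) M ⟩
      L + length e                        ≡⟨ sym bs≡ ⟩
      blocks s                            ∎
      where
      open ≤-Reasoning
      count : ∀ a b c → a + b + c ≡ a + c + b
      count = solve-∀
      c′≤k : length D.c′ ≤ k
      c′≤k = subst (_≤ k) (blocks-noStutter (noStutter-++⁻ˡ D.c′ D.noStutter)) (blocks-sorted D.c′ D.sorted)

    furtherRound : ∀ m → blocks s ≤ m → Result m c₀ s
    furtherRound zero    bs≤0 = contradiction (≤-trans 1≤M (≤-trans (m≤n+m M _) (≤-trans bs′≤ bs≤0))) λ ()
    furtherRound (suc m) bs≤  = record
      { is = D.is ++ R.is ; s′ = R.s′ ; path = ⟶-trans D.path R.path ; sorted = R.sorted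
      ; count = bound
      ; optimal = inj₂ (≤-trans (m≤m+n L (length e)) (≤-reflexive (sym bs≡)))
      ; run = λ {ro} K → ⟿-bind (⟿-bind (go K) D.run) λ K →
          subst (λ ro → _ ⟿[ _ ] Halted ro) (encode-++ ro)
            (subst (λ l → _ ⟿[ suc m * roundTime l ] Halted (encode R.is ʳ++ (encode D.is ʳ++ ro)))
              D.length≡ (R.run K)) }
      where
      module R = Result (rounds m D.s′ D.bounded D.finished
        (≤-pred (≤-trans (≤-trans (≤-reflexive (+-comm 1 (blocks D.s′))) (+-monoʳ-≤ (blocks D.s′) 1≤M)) (≤-trans bs′≤ bs≤))))

      encode-++ : ∀ ro → encode R.is ʳ++ (encode D.is ʳ++ ro) ≡ encode (D.is ++ R.is) ʳ++ ro
      encode-++ ro = trans (sym (++-ʳ++ (encode D.is)))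
        (cong (_ʳ++ ro) (sym (concatMap-++ (λ i → replicate i tally ++ end ∷ []) D.is R.is)))

      bound : length (D.is ++ R.is) * M ≤ blocks s * (M + 4 * k) + 3 * k * M
      bound = begin
        length (D.is ++ R.is) * M
          ≡⟨ cong (_* M) (length-++ D.is) ⟩
        (length D.is + length R.is) * M
          ≡⟨ *-distribʳ-+ M (length D.is) (length R.is) ⟩
        length D.is * M + length R.is * M
          ≤⟨ +-mono-≤ (*-monoˡ-≤ M D.count) R.count ⟩
        (k + M + 3 * k) * M + (blocks D.s′ * (M + 4 * k) + 3 * k * M)
          ≡⟨ count k M (blocks D.s′) ⟩
        (blocks D.s′ + M) * (M + 4 * k) + 3 * k * M
          ≤⟨ +-monoˡ-≤ (3 * k * M) (*-monoˡ-≤ (M + 4 * k) bs′≤) ⟩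
        blocks s * (M + 4 * k) + 3 * k * M ∎
        where
        open ≤-Reasoning
        count : ∀ k M b → (k + M + 3 * k) * M + (b * (M + 4 * k) + 3 * k * M) ≡ (b + M) * (M + 4 * k) + 3 * k * M
        count = solve-∀

  -- Substituting b ≤ n + k leaves nM and the overhead 4kn + 4kM + 4kk. From L ≤ b follows M ≤ n, so
  -- each overhead term is at most 4kn; multiplied by q they total 12kqn = Mn, the one extra share
  -- of n.
  ratio : ∀ a b n → a * M ≤ b * (M + 4 * k) + 3 * k * M → L ≤ b → b ≤ n + k → q * a ≤ suc q * n
  ratio a b n a≤ L≤b b≤ = *-cancelʳ-≤ (q * a) (suc q * n) M ⦃ >-nonZero 1≤M ⦄ (begin
    q * a * M                                         ≡⟨ *-assoc q a M ⟩
    q * (a * M)                                       ≤⟨ *-monoʳ-≤ q a≤ ⟩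
    q * (b * (M + 4 * k) + 3 * k * M)                 ≤⟨ *-monoʳ-≤ q (+-monoˡ-≤ (3 * k * M) (*-monoˡ-≤ (M + 4 * k) b≤)) ⟩
    q * ((n + k) * (M + 4 * k) + 3 * k * M)           ≡⟨ expand q n k M ⟩
    q * (n * M + 4 * k * n + 4 * k * M + 4 * k * k)   ≤⟨ *-monoʳ-≤ q (+-mono-≤ (+-monoʳ-≤ (n * M + 4 * k * n)
                                                           (*-monoʳ-≤ (4 * k) M≤n)) (*-monoʳ-≤ (4 * k) (≤-trans k≤M M≤n))) ⟩
    q * (n * M + 4 * k * n + 4 * k * n + 4 * k * n)   ≡⟨ collect q n k M ⟩
    q * n * M + 12 * k * q * n                        ≡⟨ factor q n M ⟩
    suc q * n * M                                     ∎)
    where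
    open ≤-Reasoning
    M≤n : M ≤ n
    M≤n = +-cancelʳ-≤ k M n (≤-trans (≤-reflexive (+-comm M k)) (≤-trans L≤b b≤))
    expand : ∀ q n k M → q * ((n + k) * (M + 4 * k) + 3 * k * M) ≡ q * (n * M + 4 * k * n + 4 * k * M + 4 * k * k)
    expand = solve-∀
    collect : ∀ q n k M → q * (n * M + 4 * k * n + 4 * k * n + 4 * k * n) ≡ q * n * M + 12 * k * q * n
    collect = solve-∀
    factor : ∀ q n M → q * n * M + M * n ≡ suc q * n * M
    factor = solve-∀

  abstract
    result : ∀ s → Result (length s) [] s
    result s = rounds (length s) s z≤n (nextFlip-sorted {c = []} []) (blocks≤length s)

  flips : Str k → List ℕ
  flips = Result.is ∘ result

  flips-sort : ∀ s → s ⟶⟨ flips s ⟩ I s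
  flips-sort s = ⟶-sorted path sorted
    where open Result (result s)

  flips-ratio : ∀ s n → Sortable n s → q * length (flips s) ≤ suc q * n
  flips-ratio s n S with Result.optimal (result s)
  ... | inj₁ opt = ≤-trans (*-monoʳ-≤ q (opt n S)) (*-monoˡ-≤ n (n≤1+n q))
  ... | inj₂ L≤b = ratio (length (flips s)) (blocks s) n (Result.count (result s)) L≤b (blocks-sortable n s S)

  -- With N = L + 3k, l + 1 rounds of linear cost take at most (5N + 3)(l + 1)^2 steps. Bounding 2l
  -- by 1 + l^2 doubles the coefficient to 10N + 6, and the starting step makes it 10N + 7.
  timeFactor : ℕ
  timeFactor = 10 * (L + 3 * k) + 7

  flips-polyTime : PolyTime (encode ∘ flips)
  flips-polyTime = machine , timeFactor , 2 , within
    where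
    within : ∀ w → ComputesWithin w (encode (flips w)) (timeFactor * length w ^ 2 + timeFactor)
    within w with ⟿-bind (start-home w) (Result.run (result w))
    ... | n , _ , n≤ , steps , (stop , Q , S , B , refl) =
      -- The one trailing blank is the cell under the output head, which rests just behind the last
      -- mark.
      n , _ , steps-run steps stop , (0 , 1 , out) , ≤-trans n≤ (time (length w) (L + 3 * k))
      where
      out : reverse (map (just ∘ inj₂) (encode (flips w) ʳ++ [])) ++ nothing ∷ [] ≡
            map just (map inj₂ (encode (flips w))) ++ nothing ∷ []
      out = cong (_++ nothing ∷ []) (begin
        reverse (map (just ∘ inj₂) (reverse (encode (flips w)))) ≡⟨ cong reverse (reverse-map _ (encode (flips w))) ⟩
        reverse (reverse (map (just ∘ inj₂) (encode (flips w)))) ≡⟨ reverse-involutive _ ⟩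
        map (just ∘ inj₂) (encode (flips w))                     ≡⟨ map-∘ (encode (flips w)) ⟩
        map just (map inj₂ (encode (flips w)))                   ∎)
        where open ≡-Reasoning

      time : ∀ l N → 1 + suc l * ((2 * l + 3) + N * (5 * l + 5)) ≤ (10 * N + 7) * l ^ 2 + (10 * N + 7)
      time l N = begin
        1 + suc l * ((2 * l + 3) + N * (5 * l + 5))              ≤⟨ +-monoʳ-≤ 1 (*-monoʳ-≤ (suc l) (+-monoˡ-≤ _ 2l+3≤)) ⟩
        1 + suc l * (3 * suc l + N * (5 * l + 5))                ≡⟨ square l N ⟩
        1 + (5 * N + 3) * (1 + l * l + 2 * l)                    ≤⟨ +-monoʳ-≤ 1 (*-monoʳ-≤ (5 * N + 3) (+-monoʳ-≤ (1 + l * l) (2l≤ l))) ⟩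
        1 + (5 * N + 3) * (1 + l * l + (1 + l * l))              ≤⟨ m≤m+n _ (l * l) ⟩
        1 + (5 * N + 3) * (1 + l * l + (1 + l * l)) + l * l      ≡⟨ total l N ⟩
        (10 * N + 7) * l ^ 2 + (10 * N + 7)                      ∎
        where
        open ≤-Reasoning
        2l+3≤ : 2 * l + 3 ≤ 3 * suc l
        2l+3≤ = ≤-trans (m≤n+m _ l) (≤-reflexive (lemma l))
          where
          lemma : ∀ l → l + (2 * l + 3) ≡ 3 * suc l
          lemma = solve-∀
        2l≤ : ∀ l → 2 * l ≤ 1 + l * l
        2l≤ zero          = z≤n
        2l≤ (suc zero)    = ≤-refl
        2l≤ (suc (suc l)) = m≤n⇒m≤1+n (*-monoˡ-≤ (suc (suc l)) {2} {suc (suc l)} (s≤s (s≤s z≤n)))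
        square : ∀ l N → 1 + suc l * (3 * suc l + N * (5 * l + 5)) ≡ 1 + (5 * N + 3) * (1 + l * l + 2 * l)
        square = solve-∀
        total : ∀ l N → 1 + (5 * N + 3) * (1 + l * l + (1 + l * l)) + l * l ≡ (10 * N + 7) * (l * (l * 1)) + (10 * N + 7)
        total = solve-∀

-- From natural to rational inequalities

module _ where

  open import Data.Nat.Base using (_+_; _*_; _≤_)

  -- A positive ε has numerator at least 1, so 1 + 1/q ≤ 1 + ε for its denominator q.
  fromℕ-ratio : ∀ a d (ε : ℚ) → 0ℚ ℚ.< ε → ℚ.↧ₙ ε * a ≤ suc (ℚ.↧ₙ ε) * d → fromℕ a ℚ.≤ (1ℚ ℚ.+ ε) ℚ.* fromℕ d
  fromℕ-ratio a d (mkℚ (ℤ.+ 0) _ _)       (ℚ.*<* (ℤ.+<+ ())) _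
  fromℕ-ratio a d (mkℚ (ℤ.-[1+ _ ]) _ _)  (ℚ.*<* ()) _
  fromℕ-ratio a d ε@(mkℚ (ℤ.+ suc p) q-1 _) _ qa≤ = ℚ.toℚᵘ-cancel-≤ (begin
    toℚᵘ (fromℕ a)                               ≃⟨ toℚᵘ-fromℕ a ⟩
    mkℚᵘ (ℤ.+ a) 0                               ≤⟨ *≤* main ⟩
    (ℚᵘ.1ℚᵘ ℚᵘ.+ toℚᵘ ε) ℚᵘ.* mkℚᵘ (ℤ.+ d) 0     ≃⟨ ℚᵘ.*-cong (ℚᵘ.≃-sym (ℚ.toℚᵘ-homo-+ 1ℚ ε)) (ℚᵘ.≃-sym (toℚᵘ-fromℕ d)) ⟩
    toℚᵘ (1ℚ ℚ.+ ε) ℚᵘ.* toℚᵘ (fromℕ d)          ≃⟨ ℚᵘ.≃-sym (ℚ.toℚᵘ-homo-* (1ℚ ℚ.+ ε) (fromℕ d)) ⟩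
    toℚᵘ ((1ℚ ℚ.+ ε) ℚ.* fromℕ d)                ∎)
    where
    open ℚᵘ.≤-Reasoning
    toℚᵘ-fromℕ : ∀ n → toℚᵘ (fromℕ n) ℚᵘ.≃ mkℚᵘ (ℤ.+ n) 0
    toℚᵘ-fromℕ n = ℚ.toℚᵘ-fromℚᵘ (mkℚᵘ (ℤ.+ n) 0)
    q = suc q-1
    numerator : (ℤ.1ℤ ℤ.* ℤ.+ q ℤ.+ ℤ.+ suc p ℤ.* ℤ.1ℤ) ℤ.* ℤ.+ d ℤ.* ℤ.1ℤ ≡ ℤ.+ ((q + suc p) * d)
    numerator = trans (ℤ.*-identityʳ _) (trans
      (cong₂ (λ x y → (x ℤ.+ y) ℤ.* ℤ.+ d) (ℤ.*-identityˡ (ℤ.+ q)) (ℤ.*-identityʳ (ℤ.+ suc p)))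
      (sym (ℤ.pos-* (q + suc p) d)))
    denominator : a * (1 * q * 1) ≡ q * a
    denominator = trans (cong (a *_) (trans (*-identityʳ (1 * q)) (*-identityˡ q))) (*-comm a q)
    main : ℤ.+ a ℤ.* ℤ.+ (1 * q * 1) ℤ.≤ (ℤ.1ℤ ℤ.* ℤ.+ q ℤ.+ ℤ.+ suc p ℤ.* ℤ.1ℤ) ℤ.* ℤ.+ d ℤ.* ℤ.1ℤ
    main = subst₂ ℤ._≤_ (trans (cong ℤ.+_ (sym denominator)) (ℤ.pos-* a (1 * q * 1))) (sym numerator)
      (ℤ.+≤+ (≤-trans qa≤ (*-monoˡ-≤ d (≤-trans (≤-reflexive (+-comm 1 q)) (+-monoʳ-≤ q (s≤s z≤n))))))

  flips-near-optimal : ∀ (k : ℕ) (ε : ℚ) → .⦃ _ : NonZero k ⦄ → 0ℚ ℚ.< ε → let open Approximation k (ℚ.↧ₙ ε) in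
    ∀ s → ∃[ d ] IsSortingDistance s d × fromℕ (length (flips s)) ℚ.≤ (1ℚ ℚ.+ ε) ℚ.* fromℕ d
  flips-near-optimal k ε 0<ε s with d , S , min ← sorting-distance s =
    d , isSortingDistance S min , fromℕ-ratio (length (flips s)) d ε 0<ε (flips-ratio s d S)
    where open Approximation k (ℚ.↧ₙ ε)

open import Data.Nat.Base using () renaming (_≤_ to _≤ℕ_)
open import Data.Rational.Base using (_<_; _≤_; _+_; _*_)

theorem4p8 : (k : ℕ) → 2 ≤ℕ k → (ε : ℚ) → 0ℚ < ε →
    Σ (Str k → List ℕ) λ algorithm →
    PolyTime (encode ∘ algorithm) ×
    (∀ (s : Str k) →
    (s ⟶⟨ algorithm s ⟩ I s) ×
    (∃[ d ] IsSortingDistance s d ×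
    fromℕ (length (algorithm s)) ≤ (1ℚ + ε) * fromℕ d))
theorem4p8 k@(suc _) _ ε 0<ε =
  flips , flips-polyTime , λ s → flips-sort s , flips-near-optimal k ε 0<ε s
  where open Approximation k (ℚ.↧ₙ ε)
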